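{- Define sequences $(x_i)_{i\ge1}$, $(b_i)_{i\ge1}$, $(l_i)_{i\ge1}$ by: for $1\le i\le 5$, $x_i=(0,1)$, $b_i=2$, $l_i=0$; for $i\ge 6$, $x_i=P_{i,i^2}$, $b_i=2^i$, $l_i=2^{4i^2}$. Let $Q=(q_n)$ and $x$ be the basic sequence and real number associated with $(l_i),(b_i),(x_i)$ as described in the context. Then $x$ is $Q$-normal.
   Context: A block of length $k$ is a $k$-tuple of non-negative integers; $|B|$ denotes the length of a block $B$. For a positive integer $b$, define the weighting $\nu_b$ on digits by $\nu_b(j)=2^{ -b}$ for $0\le j\le b-1$, $\nu_b(b)=(2^b-b)/2^b$, $\nu_b(j)=0$ for $j>b$, and for a block $B=(c_1,\dots,c_k)$ set $\nu_b(B)=\prod_{j=1}^k\nu_b(c_j)$. For positive integers $b,w$, let $P_1,P_2,\dots,P_{(b+1)^w}$ be all blocks of length $w$ with digits in $\{0,1,\dots,b\}$, listed in lexicographic order, and let $P_{b,w}$ be the block obtained by concatenating $2^{bw}\nu_b(P_1)$ copies of $P_1$, then $2^{bw}\nu_b(P_2)$ copies of $P_2$, and so on up to $P_{(b+1)^w}$ (these multiplicities equal $(2^b-b)^{g}$ where $g$ is the number of digits equal to $b$ in the block, hence are integers). Associated $Q$ and $x$: given sequences of non-negative integers $(l_i)$, $(b_i)$ with $b_i\ge2$ and blocks $(x_i)$, put $L_0=0$, $L_i=\sum_{j=1}^i l_j|x_j|$, $q_n=b_i$ for $L_{i-1}<n\le L_i$, $Q=(q_n)_{n\ge1}$; let $(E_1,E_2,\dots)$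 be the infinite digit sequence formed by concatenating $l_1$ copies of $x_1$, then $l_2$ copies of $x_2$, then $l_3$ copies of $x_3$, etc.; and set $x=\sum_{n\ge1}E_n/(q_1q_2\cdots q_n)$. A basic sequence is a sequence $Q=(q_n)$ of integers $q_n\ge2$. The $Q$-Cantor series expansion of $x\in[0,1)$ is the unique expansion $x=\sum_{n\ge1}E_n/(q_1\cdots q_n)$ with $E_n\in\{0,\dots,q_n-1\}$ and $E_n\ne q_n-1$ infinitely often. $N_n^Q(B,x)$ denotes the number of positions $s\le n$ at which the block $B$ occurs (starting at position $s$) in the digit sequence $(E_n)$ of the $Q$-Cantor expansion of $x$. Set $Q_n^{(k)}=\sum_{j=1}^n \frac{1}{q_jq_{j+1}\cdots q_{j+k-1}}$. The number $x$ is $Q$-normal if for every $k\ge1$ and every block $B$ of length $k$, $\lim_{n\to\infty}N_n^Q(B,x)/Q_n^{(k)}=1$. -}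

module Defs where

open import Data.Nat using (ℕ; zero; suc; _+_; _*_; _∸_; _^_; _≤_; _<_; _≤ᵇ_; _<ᵇ_; _≡ᵇ_; NonZero)
open import Data.Nat.Properties using (m*n≢0; m^n≢0)
open import Data.Nat.DivMod using (_%_)
open import Data.Bool using (Bool; true; false; if_then_else_)
open import Data.List using (List; []; _∷_; map; concat; concatMap; replicate; length; upTo)
open import Data.Nat.ListAction using (product)
open import Data.List.Properties using (≡-dec)
import Data.Nat as ℕ
open import Data.Integer using (+_)
open import Data.Rational using (ℚ; 0ℚ; _/_; _÷_; ≢-nonZero)
import Data.Rational as ℚ
open import Relation.Nullary using (yes; no; ¬_)
open import Data.Product using (Σ; _×_)
open import Relation.Binary.PropositionalEquality using (_≡_)

Block : Set
Block = List ℕ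

-- 2^b · ν_b(j)  (integer-valued rescaling of the weighting ν_b on digits)
νscaled : ℕ → ℕ → ℕ
νscaled b j = if j <ᵇ b then 1 else (if j ≡ᵇ b then 2 ^ b ∸ b else 0)

-- 2^{b|B|} · ν_b(B) = ∏_j 2^b ν_b(c_j)
mult : ℕ → Block → ℕ
mult b B = product (map (νscaled b) B)

allBlocks : ℕ → ℕ → List Block
allBlocks b zero    = [] ∷ []
allBlocks b (suc w) = concatMap (λ d → map (d ∷_) (allBlocks b w)) (upTo (suc b))

P : ℕ → ℕ → Block
P b w = concatMap (λ B → concat (replicate (mult b B) B)) (allBlocks b w)

-- the sequences x_i, b_i, l_i (indexed from i = 1; the value at i = 0 is irrelevant)
xs : ℕ → Block
xs i = if i ≤ᵇ 5 then (0 ∷ 1 ∷ []) else P i (i * i)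

bs : ℕ → ℕ
bs i = if i ≤ᵇ 5 then 2 else 2 ^ i

ls : ℕ → ℕ
ls i = if i ≤ᵇ 5 then 0 else 2 ^ (4 * (i * i))

L : ℕ → ℕ
L zero    = 0
L (suc i) = L i + ls (suc i) * length (xs (suc i))

search : ℕ → ℕ → ℕ → ℕ
search n start zero       = start
search n start (suc fuel) = if n ≤ᵇ L start then start else search n (suc start) fuel

-- for n ≥ 1: the unique i ≥ 1 with L_{i-1} < n ≤ L_i
-- (since L_i ≥ i - 5, the search bound n + 6 suffices)
seg : ℕ → ℕ
seg n = search n 1 (n + 6)

nth : List ℕ → ℕ → ℕ
nth []       _       = 0
nth (a ∷ _)  zero    = a
nth (_ ∷ as) (suc k) = nth as k

q : ℕ → ℕ
q n = bs (seg n)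

-- E_n : n-th digit (n ≥ 1) of l_1 copies of x_1, l_2 copies of x_2, …
E : ℕ → ℕ
E n = let i = seg n in
      let x = xs i in
      nth x (((n ∸ L (i ∸ 1)) ∸ 1) % suc (length x ∸ 1))
      -- |x_i| ≥ 1 always, so suc (|x_i| - 1) = |x_i|

bs-nz : ∀ i → NonZero (bs i)
bs-nz i with i ≤ᵇ 5
... | true  = _
... | false = m^n≢0 2 i

q-nz : ∀ n → NonZero (q n)
q-nz n = bs-nz (seg n)

qprod : ℕ → ℕ → ℕ
qprod j zero    = 1
qprod j (suc k) = q j * qprod (suc j) k

qprod-nz : ∀ j k → NonZero (qprod j k)
qprod-nz j zero    = _
qprod-nz j (suc k) = m*n≢0 (q j) (qprod (suc j) k) {{q-nz j}} {{qprod-nz (suc j) k}}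

Qk : ℕ → ℕ → ℚ
Qk zero    k = 0ℚ
Qk (suc n) k = Qk n k ℚ.+ ((+ 1) / qprod (suc n) k) {{qprod-nz (suc n) k}}

occursAt : Block → ℕ → Bool
occursAt B s with ≡-dec ℕ._≟_ (map (λ t → E (s + t)) (upTo (length B))) B
... | yes _ = true
... | no  _ = false

N : Block → ℕ → ℕ
N B zero    = 0
N B (suc n) = (if occursAt B (suc n) then 1 else 0) + N B n

-- a / b in ℚ, used only when b ≠ 0 (value 0 when b = 0)
ratio : ℚ → ℚ → ℚ
ratio a b with b ℚ.≟ 0ℚ
... | yes _  = 0ℚ
... | no b≢0 = (a ÷ b) {{≢-nonZero b≢0}}

-- (E_n) is a valid Q-Cantor digit sequence: E_n ∈ {0,…,q_n - 1}, E_n ≠ q_n - 1 infinitely often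
-- (by uniqueness, it is then THE Q-Cantor expansion of x = Σ E_n/(q_1⋯q_n))
ValidDigits : Set
ValidDigits = (∀ n → 1 ≤ n → E n < q n)
            × (∀ m → Σ ℕ (λ n → m ≤ n × ¬ (E n ≡ q n ∸ 1)))

QNormal : Set
QNormal = ∀ (k : ℕ) → 1 ≤ k → (B : Block) → length B ≡ k →
          ∀ (ε : ℚ) → 0ℚ ℚ.< ε →
          Σ ℕ (λ M → ∀ n → M ≤ n →
            ℚ.∣ ratio (((+ (N B n)) / 1)) (Qk n k) ℚ.- ℚ.1ℚ ∣ ℚ.< ε)

{-# OPTIONS --safe #-}

-- Fix a block B of length k.  One copy of x_i = P_{i,w}, w = i², is a concatenation of runs W^m, one for
-- each word W of length w, so up to k windows per run B occurs in it as often as in the periodic words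
-- W^∞.  The weights 2^{iw}ν_i(W) are multiplicative, hence invariant under rotation of W, so each of the w
-- positions of a cyclic window contributes 2^{i(w-k)}, once the digits of B are below i.  Thus a copy
-- contains w 2^{i(w-k)} occurrences up to an error k (i+1)^w, and up to the same error this is also the
-- growth of Q^{(k)} along the copy.  These errors, the segments with small i, and an unfinished copy of
-- x_{i+1} (which is short compared with the l_i copies of x_i before it) are all negligible against the
-- sum of the expected counts, so N and Q^{(k)} are both asymptotic to that sum.
module Submission where

open import Defs
open import Data.Bool using (true; false; if_then_else_; T)
import Data.Integer as ℤ
open ℤ using (+[1+_])
import Data.Integer.Properties as ℤ
open import Data.List using (List; []; _∷_; _++_; _∷ʳ_; map; concat; concatMap; replicate; length; upTo; applyUpTo)
open import Data.List.Properties using (upTo-∷ʳ; map-++; map-upTo; length-++; ≡-dec; ∷-injective)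
open import Data.List.Relation.Unary.All as All using (All; []; _∷_)
import Data.List.Relation.Unary.All.Properties as All
open import Data.Nat
open import Data.Nat.DivMod using (_%_; _/_; m<n⇒m%n≡m; [m+n]%n≡m%n; m≡m%n+[m/n]*n; m%n<n; m<n*o⇒m/o<n)
open import Data.Nat.ListAction using (sum; product)
open import Data.Nat.ListAction.Properties using (sum-++; product-++)
open import Data.Nat.Properties
open import Data.Nat.Tactic.RingSolver using (solve-∀)
open import Data.Product using (∃; _×_; _,_)
open import Data.Rational as ℚ using (ℚ; mkℚ; 0ℚ; 1ℚ; toℚᵘ)
import Data.Rational.Properties as ℚ
import Data.Rational.Solver as ℚ
open ℚ.+-*-Solver using (solve; _:=_; _:+_; _:-_; :-_; _:*_; con)
open import Data.Rational.Unnormalised as ℚᵘ using (mkℚᵘ; *≡*; *≤*)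
import Data.Rational.Unnormalised.Properties as ℚᵘ
open import Data.Sum using (inj₁; inj₂)
open import Function using (_∘_)
open import Relation.Binary.PropositionalEquality hiding (J)
open import Relation.Nullary using (yes; no; contradiction)

-- Finite sums over lists and initial segments, and two-sided error bounds.

+-interchange : ∀ a b c d → a + b + (c + d) ≡ a + c + (b + d)
+-interchange = solve-∀

∑ : {A : Set} → (A → ℕ) → List A → ℕ
∑ F xs = sum (map F xs)

module _ {A : Set} where

  ∑-++ : ∀ (F : A → ℕ) xs ys → ∑ F (xs ++ ys) ≡ ∑ F xs + ∑ F ys
  ∑-++ F xs ys = trans (cong sum (map-++ F xs ys)) (sum-++ (map F xs) (map F ys))

  ∑-cong : ∀ {F G : A → ℕ} → (∀ x → F x ≡ G x) → ∀ xs → ∑ F xs ≡ ∑ G xs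
  ∑-cong F≗G []       = refl
  ∑-cong F≗G (x ∷ xs) = cong₂ _+_ (F≗G x) (∑-cong F≗G xs)

  ∑-+ : ∀ (F G : A → ℕ) xs → ∑ (λ x → F x + G x) xs ≡ ∑ F xs + ∑ G xs
  ∑-+ F G []       = refl
  ∑-+ F G (x ∷ xs) = trans (cong (F x + G x +_) (∑-+ F G xs))
                           (+-interchange (F x) (G x) (∑ F xs) (∑ G xs))

  ∑-*ˡ : ∀ c (F : A → ℕ) xs → ∑ (λ x → c * F x) xs ≡ c * ∑ F xs
  ∑-*ˡ c F []       = sym (*-zeroʳ c)
  ∑-*ˡ c F (x ∷ xs) = trans (cong (c * F x +_) (∑-*ˡ c F xs)) (sym (*-distribˡ-+ c _ _))

  ∑-*ʳ : ∀ c (F : A → ℕ) xs → ∑ (λ x → F x * c) xs ≡ ∑ F xs * c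
  ∑-*ʳ c F xs = trans (∑-cong (λ x → *-comm (F x) c) xs) (trans (∑-*ˡ c F xs) (*-comm c _))

  ∑-const : ∀ c (xs : List A) → ∑ (λ _ → c) xs ≡ length xs * c
  ∑-const c []       = refl
  ∑-const c (_ ∷ xs) = cong (c +_) (∑-const c xs)

module _ {A B : Set} where

  ∑-swap : ∀ (F : A → B → ℕ) xs ys →
           ∑ (λ x → ∑ (F x) ys) xs ≡ ∑ (λ y → ∑ (λ x → F x y) xs) ys
  ∑-swap F []       ys = sym (trans (∑-const 0 ys) (*-zeroʳ (length ys)))
  ∑-swap F (x ∷ xs) ys = trans (cong (∑ (F x) ys +_) (∑-swap F xs ys)) (sym (∑-+ (F x) _ ys))

  ∑-map : ∀ (F : B → ℕ) (g : A → B) xs → ∑ F (map g xs) ≡ ∑ (F ∘ g) xs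
  ∑-map F g []       = refl
  ∑-map F g (x ∷ xs) = cong (F (g x) +_) (∑-map F g xs)

  ∑-concatMap : ∀ (F : B → ℕ) (g : A → List B) xs →
                ∑ F (concatMap g xs) ≡ ∑ (λ x → ∑ F (g x)) xs
  ∑-concatMap F g []       = refl
  ∑-concatMap F g (x ∷ xs) = trans (∑-++ F (g x) _) (cong (∑ F (g x) +_) (∑-concatMap F g xs))

∑< : (ℕ → ℕ) → ℕ → ℕ
∑< g n = ∑ g (upTo n)

∑<-suc : ∀ g n → ∑< g (suc n) ≡ ∑< g n + g n
∑<-suc g n = begin
  ∑ g (upTo (suc n))     ≡⟨ cong (∑ g) (upTo-∷ʳ n) ⟨
  ∑ g (upTo n ∷ʳ n)      ≡⟨ ∑-++ g (upTo n) (n ∷ []) ⟩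
  ∑< g n + (g n + 0)     ≡⟨ cong (∑< g n +_) (+-identityʳ (g n)) ⟩
  ∑< g n + g n           ∎
  where open ≡-Reasoning

∑<-cong : ∀ {g h} n → (∀ p → p < n → g p ≡ h p) → ∑< g n ≡ ∑< h n
∑<-cong         zero    eq = refl
∑<-cong {g} {h} (suc n) eq = begin
  ∑< g (suc n)   ≡⟨ ∑<-suc g n ⟩
  ∑< g n + g n   ≡⟨ cong₂ _+_ (∑<-cong n (λ p p<n → eq p (m<n⇒m<1+n p<n))) (eq n ≤-refl) ⟩
  ∑< h n + h n   ≡⟨ ∑<-suc h n ⟨
  ∑< h (suc n)   ∎
  where open ≡-Reasoning

∑<-const : ∀ c n → ∑< (λ _ → c) n ≡ n * c
∑<-const c zero    = refl
∑<-const c (suc n) = trans (∑<-suc _ n) (trans (cong (_+ c) (∑<-const c n)) (+-comm (n * c) c))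

∑<-+ : ∀ g a b → ∑< g (a + b) ≡ ∑< g a + ∑< (λ p → g (a + p)) b
∑<-+ g a zero    = trans (cong (∑< g) (+-identityʳ a)) (sym (+-identityʳ _))
∑<-+ g a (suc b) = begin
  ∑< g (a + suc b)                               ≡⟨ cong (∑< g) (+-suc a b) ⟩
  ∑< g (suc (a + b))                             ≡⟨ ∑<-suc g (a + b) ⟩
  ∑< g (a + b) + g (a + b)                       ≡⟨ cong (_+ g (a + b)) (∑<-+ g a b) ⟩
  ∑< g a + ∑< (λ p → g (a + p)) b + g (a + b)    ≡⟨ +-assoc (∑< g a) _ _ ⟩
  ∑< g a + (∑< (λ p → g (a + p)) b + g (a + b))  ≡⟨ cong (∑< g a +_) (∑<-suc _ b) ⟨
  ∑< g a + ∑< (λ p → g (a + p)) (suc b)          ∎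
  where open ≡-Reasoning

∑<-≤ : ∀ {g} n → (∀ p → g p ≤ 1) → ∑< g n ≤ n
∑<-≤     zero    g≤1 = z≤n
∑<-≤ {g} (suc n) g≤1 = begin
  ∑< g (suc n)  ≡⟨ ∑<-suc g n ⟩
  ∑< g n + g n  ≤⟨ +-mono-≤ (∑<-≤ n g≤1) (g≤1 n) ⟩
  n + 1         ≡⟨ +-comm n 1 ⟩
  suc n         ∎
  where open ≤-Reasoning

-- Stands for |x - g| ≤ R, written as two additive inequalities so that truncated subtraction never
-- enters and errors simply add up.
record Near (x g R : ℕ) : Set where
  constructor near
  field
    upper : x ≤ g + R
    lower : g ≤ x + R

Near-+ : ∀ {x g R x′ g′ R′} → Near x g R → Near x′ g′ R′ → Near (x + x′) (g + g′) (R + R′)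
Near-+ {x} {g} {R} {x′} {g′} {R′} (near u l) (near u′ l′) = near
  (≤-trans (+-mono-≤ u u′) (≤-reflexive (+-interchange g R g′ R′)))
  (≤-trans (+-mono-≤ l l′) (≤-reflexive (+-interchange x R x′ R′)))

-- Counting the positions at which a block matches.

[_≟₀₁_] : ℕ → ℕ → ℕ
[ c ≟₀₁ d ] = if c ≡ᵇ d then 1 else 0

≟₀₁-refl : ∀ c → [ c ≟₀₁ c ] ≡ 1
≟₀₁-refl zero    = refl
≟₀₁-refl (suc c) = ≟₀₁-refl c

≟₀₁-≢ : ∀ {c d} → c ≢ d → [ c ≟₀₁ d ] ≡ 0
≟₀₁-≢ {zero}  {zero}  c≢d = contradiction refl c≢d
≟₀₁-≢ {zero}  {suc d} c≢d = refl
≟₀₁-≢ {suc c} {zero}  c≢d = refl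
≟₀₁-≢ {suc c} {suc d} c≢d = ≟₀₁-≢ (c≢d ∘ cong suc)

≟₀₁-≤1 : ∀ c d → [ c ≟₀₁ d ] ≤ 1
≟₀₁-≤1 c d with c ≡ᵇ d
... | true  = ≤-refl
... | false = z≤n

-- A product of 0/1 indicators, so that it factorises digit by digit just as `mult` does. The text
-- is a function rather than a list because windows run past the end of a word, either cyclically or
-- into the next word.
match : Block → (ℕ → ℕ) → ℕ
match []      f = 1
match (c ∷ B) f = [ c ≟₀₁ f 0 ] * match B (f ∘ suc)

match-cong : ∀ B {f g} → (∀ r → r < length B → f r ≡ g r) → match B f ≡ match B g
match-cong []      f≗g = refl
match-cong (c ∷ B) f≗g =
  cong₂ _*_ (cong [ c ≟₀₁_] (f≗g 0 z<s)) (match-cong B (λ r r<k → f≗g (suc r) (s<s r<k)))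

match≤1 : ∀ B f → match B f ≤ 1
match≤1 []      f = ≤-refl
match≤1 (c ∷ B) f = *-mono-≤ (≟₀₁-≤1 c (f 0)) (match≤1 B (f ∘ suc))

-- Starting positions lie below `n`, but a window may extend beyond, as in `N`. Hence `cnt-+` splits
-- a range with no boundary term.
cnt : Block → (ℕ → ℕ) → ℕ → ℕ
cnt B f n = ∑< (λ p → match B (λ r → f (p + r))) n

cnt-cong : ∀ B {f g} n → (∀ t → f t ≡ g t) → cnt B f n ≡ cnt B g n
cnt-cong B {f} {g} n f≗g = ∑<-cong n (λ p _ →
  match-cong B {λ r → f (p + r)} {λ r → g (p + r)} (λ r _ → f≗g (p + r)))

cnt-+ : ∀ B f a b → cnt B f (a + b) ≡ cnt B f a + cnt B (λ t → f (a + t)) b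
cnt-+ B f a b = trans (∑<-+ _ a b) (cong (cnt B f a +_) (∑<-cong b (λ p _ →
  match-cong B {λ r → f (a + p + r)} {λ r → f (a + (p + r))} (λ r _ → cong f (+-assoc a p r)))))

cnt≤ : ∀ B f n → cnt B f n ≤ n
cnt≤ B f n = ∑<-≤ n (λ p → match≤1 B _)

-- Only the last |B| windows can see letters beyond the first n.
cnt-near : ∀ B {f g} n → (∀ t → t < n → f t ≡ g t) → Near (cnt B f n) (cnt B g n) (length B)
cnt-near B {f} {g} n f≗g with ≤-total n (length B)
... | inj₁ n≤k = near
  (≤-trans (cnt≤ B f n) (≤-trans n≤k (m≤n+m _ _)))
  (≤-trans (cnt≤ B g n) (≤-trans n≤k (m≤n+m _ _)))
... | inj₂ k≤n = subst (λ m → Near (cnt B f m) (cnt B g m) k) m+k≡n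
  (near (bound f g eq) (bound g f (sym eq)))
  where
  k = length B
  m = n ∸ k
  m+k≡n : m + k ≡ n
  m+k≡n = m∸n+n≡m k≤n
  eq : cnt B f m ≡ cnt B g m
  eq = ∑<-cong m (λ p p<m → match-cong B (λ r r<k →
         f≗g (p + r) (<-≤-trans (+-mono-< p<m r<k) (≤-reflexive m+k≡n))))
  bound : ∀ f g → cnt B f m ≡ cnt B g m → cnt B f (m + k) ≤ cnt B g (m + k) + k
  bound f g eq = begin
    cnt B f (m + k)                             ≡⟨ cnt-+ B f m k ⟩
    cnt B f m + cnt B (λ t → f (m + t)) k       ≤⟨ +-mono-≤ (≤-reflexive eq) (cnt≤ B (λ t → f (m + t)) k) ⟩
    cnt B g m + k                               ≤⟨ +-monoˡ-≤ k (m≤m+n _ _) ⟩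
    cnt B g m + cnt B (λ t → g (m + t)) k + k   ≡⟨ cong (_+ k) (cnt-+ B g m k) ⟨
    cnt B g (m + k) + k                         ∎
    where open ≤-Reasoning

-- Cyclic reading of words, and runs of copies.

cyc : Block → ℕ → ℕ
-- The modulus has the form used in `E`: it is visibly nonzero and equals `length W` when `W` is
-- nonempty.
cyc W n = nth W (n % suc (length W ∸ 1))

cyc-< : ∀ W {n} → n < length W → cyc W n ≡ nth W n
cyc-< (a ∷ W) n<w = cong (nth (a ∷ W)) (m<n⇒m%n≡m n<w)

cyc-periodic : ∀ W n → cyc W (length W + n) ≡ cyc W n
cyc-periodic []      n = refl
cyc-periodic (a ∷ W) n = cong (nth (a ∷ W))
  (trans (cong (_% suc (length W)) (+-comm (suc (length W)) n)) ([m+n]%n≡m%n n (suc (length W))))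

cyc-periodic* : ∀ W c n → cyc W (c * length W + n) ≡ cyc W n
cyc-periodic* W zero    n = refl
cyc-periodic* W (suc c) n = trans (cong (cyc W) (+-assoc (length W) _ n))
  (trans (cyc-periodic W (c * length W + n)) (cyc-periodic* W c n))

-- Exact, because windows starting near the end of one period wrap into the next, so all periods
-- contribute equally.
cnt-cyc : ∀ B W c → cnt B (cyc W) (c * length W) ≡ c * cnt B (cyc W) (length W)
cnt-cyc B W zero    = refl
cnt-cyc B W (suc c) = trans (cnt-+ B (cyc W) (length W) (c * length W))
  (cong (cnt B (cyc W) (length W) +_)
    (trans (cnt-cong B (c * length W) (cyc-periodic W)) (cnt-cyc B W c)))

Reads : (ℕ → ℕ) → Block → Set
Reads f X = ∀ t → t < length X → f t ≡ nth X t

nth-++ˡ : ∀ X Y {t} → t < length X → nth (X ++ Y) t ≡ nth X t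
nth-++ˡ (a ∷ X) Y {zero}  t<x       = refl
nth-++ˡ (a ∷ X) Y {suc t} (s<s t<x) = nth-++ˡ X Y t<x

nth-++ʳ : ∀ X Y t → nth (X ++ Y) (length X + t) ≡ nth Y t
nth-++ʳ []      Y t = refl
nth-++ʳ (a ∷ X) Y t = nth-++ʳ X Y t

Reads-++ˡ : ∀ {f} X Y → Reads f (X ++ Y) → Reads f X
Reads-++ˡ X Y rd t t<x = trans
  (rd t (<-≤-trans t<x (≤-trans (m≤m+n _ _) (≤-reflexive (sym (length-++ X)))))) (nth-++ˡ X Y t<x)

Reads-++ʳ : ∀ {f} X Y → Reads f (X ++ Y) → Reads (λ t → f (length X + t)) Y
Reads-++ʳ X Y rd t t<y = trans
  (rd (length X + t) (<-≤-trans (+-monoʳ-< (length X) t<y) (≤-reflexive (sym (length-++ X)))))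
  (nth-++ʳ X Y t)

power : ℕ → Block → Block
power c W = concat (replicate c W)

length-power : ∀ c W → length (power c W) ≡ c * length W
length-power zero    W = refl
length-power (suc c) W = trans (length-++ W) (cong (length W +_) (length-power c W))

Reads-power : ∀ {f} c W → Reads f (power c W) → ∀ t → t < c * length W → f t ≡ cyc W t
Reads-power {f} (suc c) W rd t t<cw with t <? length W
... | yes t<w = trans (Reads-++ˡ W (power c W) rd t t<w) (sym (cyc-< W t<w))
... | no  t≮w = begin
  f t                     ≡⟨ cong f w+s≡t ⟨
  f (length W + s)        ≡⟨ Reads-power c W (Reads-++ʳ W (power c W) rd) s s<cw ⟩
  cyc W s                 ≡⟨ cyc-periodic W s ⟨
  cyc W (length W + s)    ≡⟨ cong (cyc W) w+s≡t ⟩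
  cyc W t                 ∎
  where
  open ≡-Reasoning
  s = t ∸ length W
  w+s≡t : length W + s ≡ t
  w+s≡t = m+[n∸m]≡n (≮⇒≥ t≮w)
  s<cw : s < c * length W
  s<cw = +-cancelˡ-< (length W) s _ (subst (_< length W + c * length W) (sym w+s≡t) t<cw)

-- The error is one `length B` per run, whatever `c` is: the text agrees with the periodic word on
-- the whole run, and only windows leaving the run can differ.
cnt-power : ∀ B {f} c W → Reads f (power c W) →
            Near (cnt B f (length (power c W))) (c * cnt B (cyc W) (length W)) (length B)
cnt-power B {f} c W rd = subst₂ (λ n x → Near (cnt B f n) x (length B))
  (sym (length-power c W)) (cnt-cyc B W c)
  (cnt-near B (c * length W) (Reads-power c W rd))

-- Errors are charged per word of `𝒲`, not per copy. For `P b w` this means `suc b ^ w` words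
-- against `(2 ^ b) ^ w` copies in all, which is what makes the error negligible.
cnt-concatMap-power : ∀ B (μ : Block → ℕ) 𝒲 {f} → let X = concatMap (λ W → power (μ W) W) 𝒲 in
  Reads f X →
  Near (cnt B f (length X)) (∑ (λ W → μ W * cnt B (cyc W) (length W)) 𝒲) (length 𝒲 * length B)
cnt-concatMap-power B μ []      rd = near z≤n z≤n
cnt-concatMap-power B μ (W ∷ 𝒲) {f} rd = subst (λ x → Near x _ _)
  (trans (sym (cnt-+ B f (length X) (length Y))) (cong (cnt B f) (sym (length-++ X))))
  (Near-+ (cnt-power B (μ W) W (Reads-++ˡ X Y rd))
          (cnt-concatMap-power B μ 𝒲 (Reads-++ʳ X Y rd)))
  where
  X = power (μ W) W
  Y = concatMap (λ W → power (μ W) W) 𝒲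

length-concatMap-power : ∀ (μ : Block → ℕ) 𝒲 →
  length (concatMap (λ W → power (μ W) W) 𝒲) ≡ ∑ (λ W → μ W * length W) 𝒲
length-concatMap-power μ []      = refl
length-concatMap-power μ (W ∷ 𝒲) = trans (length-++ (power (μ W) W))
  (cong₂ _+_ (length-power (μ W) W) (length-concatMap-power μ 𝒲))

-- Sums over all words of a given length, weighted by `mult`.

∑-allBlocks-suc : ∀ F b w → ∑ F (allBlocks b (suc w)) ≡
                  ∑ (λ d → ∑ (λ W → F (d ∷ W)) (allBlocks b w)) (upTo (suc b))
∑-allBlocks-suc F b w = trans (∑-concatMap F (λ d → map (d ∷_) (allBlocks b w)) (upTo (suc b)))
  (∑-cong (λ d → ∑-map F (d ∷_) (allBlocks b w)) (upTo (suc b)))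

∑-allBlocks-cong : ∀ b w {F G : Block → ℕ} → (∀ W → length W ≡ w → F W ≡ G W) →
                   ∑ F (allBlocks b w) ≡ ∑ G (allBlocks b w)
∑-allBlocks-cong b zero            F≗G = cong (_+ 0) (F≗G [] refl)
∑-allBlocks-cong b (suc w) {F} {G} F≗G = begin
  ∑ F (allBlocks b (suc w))
    ≡⟨ ∑-allBlocks-suc F b w ⟩
  ∑ (λ d → ∑ (λ W → F (d ∷ W)) (allBlocks b w)) (upTo (suc b))
    ≡⟨ ∑-cong (λ d → ∑-allBlocks-cong b w (λ W w≡ → F≗G (d ∷ W) (cong suc w≡))) (upTo (suc b)) ⟩
  ∑ (λ d → ∑ (λ W → G (d ∷ W)) (allBlocks b w)) (upTo (suc b))
    ≡⟨ ∑-allBlocks-suc G b w ⟨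
  ∑ G (allBlocks b (suc w))
    ∎
  where open ≡-Reasoning

-- Cutting words at position `p` turns rotation into an exchange of two summations, as
-- `∑-mult-rotate` requires.
∑-allBlocks-+ : ∀ F b p r → ∑ F (allBlocks b (p + r)) ≡
                ∑ (λ u → ∑ (λ v → F (u ++ v)) (allBlocks b r)) (allBlocks b p)
∑-allBlocks-+ F b zero    r = sym (+-identityʳ _)
∑-allBlocks-+ F b (suc p) r = begin
  ∑ F (allBlocks b (suc p + r))
    ≡⟨ ∑-allBlocks-suc F b (p + r) ⟩
  ∑ (λ d → ∑ (λ W → F (d ∷ W)) (allBlocks b (p + r))) (upTo (suc b))
    ≡⟨ ∑-cong (λ d → ∑-allBlocks-+ (λ W → F (d ∷ W)) b p r) (upTo (suc b)) ⟩
  ∑ (λ d → ∑ (λ u → ∑ (λ v → F (d ∷ u ++ v)) (allBlocks b r)) (allBlocks b p)) (upTo (suc b))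
    ≡⟨ ∑-allBlocks-suc (λ u → ∑ (λ v → F (u ++ v)) (allBlocks b r)) b p ⟨
  ∑ (λ u → ∑ (λ v → F (u ++ v)) (allBlocks b r)) (allBlocks b (suc p))
    ∎
  where open ≡-Reasoning

length-allBlocks : ∀ b w → length (allBlocks b w) ≡ suc b ^ w
length-allBlocks b w = trans (sym (trans (∑-const 1 (allBlocks b w)) (*-identityʳ _))) (go w)
  where
  open ≡-Reasoning
  go : ∀ w → ∑ (λ _ → 1) (allBlocks b w) ≡ suc b ^ w
  go zero    = refl
  go (suc w) = begin
    ∑ (λ _ → 1) (allBlocks b (suc w))                       ≡⟨ ∑-allBlocks-suc (λ _ → 1) b w ⟩
    ∑< (λ _ → ∑ (λ _ → 1) (allBlocks b w)) (suc b)          ≡⟨ ∑<-const _ (suc b) ⟩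
    suc b * ∑ (λ _ → 1) (allBlocks b w)                     ≡⟨ cong (suc b *_) (go w) ⟩
    suc b ^ suc w                                           ∎

νscaled-< : ∀ {b j} → j < b → νscaled b j ≡ 1
νscaled-< {b} {j} j<b with j <ᵇ b | <⇒<ᵇ j<b
... | true | _ = refl

νscaled-top : ∀ b → νscaled b b ≡ 2 ^ b ∸ b
νscaled-top b with b <ᵇ b in eq₁ | b ≡ᵇ b in eq₂
... | true  | _     = contradiction (<ᵇ⇒< b b (subst T (sym eq₁) _)) (<-irrefl refl)
... | false | true  = refl
... | false | false = contradiction (subst T eq₂ (≡⇒≡ᵇ b b refl)) (λ ())

n≤2^n : ∀ n → n ≤ 2 ^ n
n≤2^n zero    = z≤n
n≤2^n (suc n) = begin
  suc n            ≤⟨ s≤s (n≤2^n n) ⟩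
  1 + 2 ^ n        ≤⟨ +-monoˡ-≤ (2 ^ n) (m^n>0 2 n) ⟩
  2 ^ n + 2 ^ n    ≡⟨ cong (2 ^ n +_) (+-identityʳ (2 ^ n)) ⟨
  2 ^ suc n        ∎
  where open ≤-Reasoning

∑-νscaled : ∀ b → ∑< (νscaled b) (suc b) ≡ 2 ^ b
∑-νscaled b = begin
  ∑< (νscaled b) (suc b)              ≡⟨ ∑<-suc (νscaled b) b ⟩
  ∑< (νscaled b) b + νscaled b b      ≡⟨ cong₂ _+_ (∑<-cong b (λ _ → νscaled-<)) (νscaled-top b) ⟩
  ∑< (λ _ → 1) b + (2 ^ b ∸ b)        ≡⟨ cong (_+ (2 ^ b ∸ b)) (∑<-const 1 b) ⟩
  b * 1 + (2 ^ b ∸ b)                 ≡⟨ cong (_+ (2 ^ b ∸ b)) (*-identityʳ b) ⟩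
  b + (2 ^ b ∸ b)                     ≡⟨ m+[n∸m]≡n (n≤2^n b) ⟩
  2 ^ b                               ∎
  where open ≡-Reasoning

∑<-≟₀₁ : ∀ (g : ℕ → ℕ) {c} n → c < n → ∑< (λ d → g d * [ c ≟₀₁ d ]) n ≡ g c
∑<-≟₀₁ g {c} (suc n) (s<s c≤n) with m≤n⇒m<n∨m≡n c≤n
... | inj₁ c<n = begin
  ∑< h (suc n)                    ≡⟨ ∑<-suc h n ⟩
  ∑< h n + g n * [ c ≟₀₁ n ]
    ≡⟨ cong₂ _+_ (∑<-≟₀₁ g n c<n) (trans (cong (g n *_) (≟₀₁-≢ (<⇒≢ c<n))) (*-zeroʳ (g n))) ⟩
  g c + 0                         ≡⟨ +-identityʳ (g c) ⟩
  g c                             ∎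
  where
  open ≡-Reasoning
  h : ℕ → ℕ
  h d = g d * [ c ≟₀₁ d ]
... | inj₂ refl = begin
  ∑< h (suc n)                    ≡⟨ ∑<-suc h n ⟩
  ∑< h n + g n * [ n ≟₀₁ n ]
    ≡⟨ cong₂ _+_ (∑<-cong n (λ d d<n → trans (cong (g d *_) (≟₀₁-≢ (≢-sym (<⇒≢ d<n)))) (*-zeroʳ (g d))))
                                              (trans (cong (g n *_) (≟₀₁-refl n)) (*-identityʳ (g n))) ⟩
  ∑< (λ _ → 0) n + g n            ≡⟨ cong (_+ g n) (trans (∑<-const 0 n) (*-zeroʳ n)) ⟩
  g n                             ∎
  where
  open ≡-Reasoning
  h : ℕ → ℕ
  h d = g d * [ n ≟₀₁ d ]

mult-++ : ∀ b u v → mult b (u ++ v) ≡ mult b u * mult b v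
mult-++ b u v = trans (cong product (map-++ (νscaled b) u v)) (product-++ (map (νscaled b) u) _)

-- Distributivity: the weight of `d ∷ W` splits into a factor for `d` and one for `W`, so a summand
-- that splits in the same way sums to a product. Iterating this evaluates all weighted sums over
-- words.
∑-mult-∷ : ∀ b w {F : Block → ℕ} (g : ℕ → ℕ) (G : Block → ℕ) → (∀ d W → F (d ∷ W) ≡ g d * G W) →
  ∑ (λ W → mult b W * F W) (allBlocks b (suc w)) ≡
  ∑< (λ d → νscaled b d * g d) (suc b) * ∑ (λ W → mult b W * G W) (allBlocks b w)
∑-mult-∷ b w {F} g G F≡ = begin
  ∑ (λ W → mult b W * F W) (allBlocks b (suc w))
    ≡⟨ ∑-allBlocks-suc _ b w ⟩
  ∑< (λ d → ∑ (λ W → νscaled b d * mult b W * F (d ∷ W)) (allBlocks b w)) (suc b)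
    ≡⟨ ∑-cong (λ d → ∑-cong (λ W → trans (cong (νscaled b d * mult b W *_) (F≡ d W))
                                        (lemma (νscaled b d) (mult b W) (g d) (G W))) (allBlocks b w))
              (upTo (suc b)) ⟩
  ∑< (λ d → ∑ (λ W → νscaled b d * g d * (mult b W * G W)) (allBlocks b w)) (suc b)
    ≡⟨ ∑-cong (λ d → ∑-*ˡ (νscaled b d * g d) _ (allBlocks b w)) (upTo (suc b)) ⟩
  ∑< (λ d → νscaled b d * g d * S) (suc b)
    ≡⟨ ∑-*ʳ S (λ d → νscaled b d * g d) (upTo (suc b)) ⟩
  ∑< (λ d → νscaled b d * g d) (suc b) * S
    ∎
  where
  open ≡-Reasoning
  S = ∑ (λ W → mult b W * G W) (allBlocks b w)
  lemma : ∀ x m y z → x * m * (y * z) ≡ x * y * (m * z)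
  lemma = solve-∀

-- The factor 1 is `match []`, so that this is literally the base case of `∑-mult-match`.
∑-mult-1 : ∀ b w → ∑ (λ W → mult b W * 1) (allBlocks b w) ≡ (2 ^ b) ^ w
∑-mult-1 b zero    = refl
∑-mult-1 b (suc w) = trans (∑-mult-∷ b w (λ _ → 1) (λ _ → 1) (λ _ _ → refl))
  (cong₂ _*_ (trans (∑-cong (λ d → *-identityʳ (νscaled b d)) (upTo (suc b))) (∑-νscaled b))
             (∑-mult-1 b w))

-- Each digit of `B` is below `b` and so has scaled weight 1. Prescribing it leaves a factor 1,
-- while each of the `r` free digits contributes the full mass `2 ^ b`.
∑-mult-match : ∀ b r {B} → All (_< b) B →
  ∑ (λ W → mult b W * match B (nth W)) (allBlocks b (length B + r)) ≡ (2 ^ b) ^ r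
∑-mult-match b r {[]}    []          = ∑-mult-1 b r
∑-mult-match b r {c ∷ B} (c<b ∷ B<b) = begin
  ∑ (λ W → mult b W * match (c ∷ B) (nth W)) (allBlocks b (suc (length B + r)))
    ≡⟨ ∑-mult-∷ b (length B + r) [ c ≟₀₁_] (λ W → match B (nth W)) (λ _ _ → refl) ⟩
  ∑< (λ d → νscaled b d * [ c ≟₀₁ d ]) (suc b) * _
    ≡⟨ cong₂ _*_ (trans (∑<-≟₀₁ (νscaled b) (suc b) (m<n⇒m<1+n c<b)) (νscaled-< c<b))
                 (∑-mult-match b r B<b) ⟩
  1 * (2 ^ b) ^ r
    ≡⟨ *-identityˡ _ ⟩
  (2 ^ b) ^ r
    ∎
  where open ≡-Reasoning

cyc-rotate : ∀ u v {t} → t < length (v ++ u) → cyc (u ++ v) (length u + t) ≡ nth (v ++ u) t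
cyc-rotate u v {t} t<w with t <? length v
... | yes t<v = begin
  cyc (u ++ v) (length u + t)
    ≡⟨ cyc-< (u ++ v) (<-≤-trans (+-monoʳ-< (length u) t<v) (≤-reflexive (sym (length-++ u)))) ⟩
  nth (u ++ v) (length u + t)   ≡⟨ nth-++ʳ u v t ⟩
  nth v t                       ≡⟨ nth-++ˡ v u t<v ⟨
  nth (v ++ u) t                ∎
  where open ≡-Reasoning
-- Past the end of `v` the index has gone once round the word and lands at offset `s` in `u`.
... | no t≮v = begin
  cyc (u ++ v) (length u + t)               ≡⟨ cong (λ t → cyc (u ++ v) (length u + t)) v+s≡t ⟨
  cyc (u ++ v) (length u + (length v + s))  ≡⟨ cong (cyc (u ++ v)) (+-assoc (length u) _ s) ⟨
  cyc (u ++ v) (length u + length v + s)    ≡⟨ cong (λ n → cyc (u ++ v) (n + s)) (length-++ u) ⟨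
  cyc (u ++ v) (length (u ++ v) + s)        ≡⟨ cyc-periodic (u ++ v) s ⟩
  cyc (u ++ v) s
    ≡⟨ cyc-< (u ++ v) (<-≤-trans s<u (≤-trans (m≤m+n _ _) (≤-reflexive (sym (length-++ u))))) ⟩
  nth (u ++ v) s                            ≡⟨ nth-++ˡ u v s<u ⟩
  nth u s                                   ≡⟨ nth-++ʳ v u s ⟨
  nth (v ++ u) (length v + s)               ≡⟨ cong (nth (v ++ u)) v+s≡t ⟩
  nth (v ++ u) t                            ∎
  where
  open ≡-Reasoning
  s = t ∸ length v
  v+s≡t : length v + s ≡ t
  v+s≡t = m+[n∸m]≡n (≮⇒≥ t≮v)
  s<u : s < length u
  s<u = +-cancelˡ-< (length v) s _ (subst₂ _<_ (sym v+s≡t) (length-++ v) t<w)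

-- The weight is invariant under rotation of blocks, so the position of the cyclic window is irrelevant.
∑-mult-rotate : ∀ b p r B → length B ≤ r + p →
  ∑ (λ W → mult b W * match B (λ t → cyc W (p + t))) (allBlocks b (p + r)) ≡
  ∑ (λ W → mult b W * match B (nth W)) (allBlocks b (r + p))
∑-mult-rotate b p r B k≤w = begin
  ∑ F (allBlocks b (p + r))
    ≡⟨ ∑-allBlocks-+ F b p r ⟩
  ∑ (λ u → ∑ (λ v → F (u ++ v)) (allBlocks b r)) (allBlocks b p)
    ≡⟨ ∑-allBlocks-cong b p (λ u u≡ → ∑-allBlocks-cong b r (λ v v≡ → rotate u v u≡ v≡)) ⟩
  ∑ (λ u → ∑ (λ v → G (v ++ u)) (allBlocks b r)) (allBlocks b p)
    ≡⟨ ∑-swap (λ u v → G (v ++ u)) (allBlocks b p) (allBlocks b r) ⟩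
  ∑ (λ v → ∑ (λ u → G (v ++ u)) (allBlocks b p)) (allBlocks b r)
    ≡⟨ ∑-allBlocks-+ G b r p ⟨
  ∑ G (allBlocks b (r + p))
    ∎
  where
  open ≡-Reasoning
  F G : Block → ℕ
  F W = mult b W * match B (λ t → cyc W (p + t))
  G W = mult b W * match B (nth W)
  rotate : ∀ u v → length u ≡ p → length v ≡ r → F (u ++ v) ≡ G (v ++ u)
  rotate u v refl refl = cong₂ _*_
    (trans (mult-++ b u v) (trans (*-comm (mult b u) _) (sym (mult-++ b v u))))
    (match-cong B (λ t t<k → cyc-rotate u v
      (<-≤-trans t<k (≤-trans k≤w (≤-reflexive (sym (length-++ v)))))))

-- The sums over words and over starting positions are exchanged. At each of the `w` positions
-- rotation makes the cyclic window a prefix, whose total weight `∑-mult-match` gives.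
∑-mult-cnt-cyc : ∀ b w {B} → All (_< b) B → length B ≤ w →
  ∑ (λ W → mult b W * cnt B (cyc W) (length W)) (allBlocks b w) ≡ w * (2 ^ b) ^ (w ∸ length B)
∑-mult-cnt-cyc b w {B} B<b k≤w = begin
  ∑ (λ W → mult b W * cnt B (cyc W) (length W)) (allBlocks b w)
    ≡⟨ ∑-allBlocks-cong b w (λ W w≡ → trans (cong (λ n → mult b W * cnt B (cyc W) n) w≡)
                                            (sym (∑-*ˡ (mult b W) _ (upTo w)))) ⟩
  ∑ (λ W → ∑< (λ p → mult b W * match B (λ t → cyc W (p + t))) w) (allBlocks b w)
    ≡⟨ ∑-swap (λ W p → mult b W * match B (λ t → cyc W (p + t))) (allBlocks b w) (upTo w) ⟩
  ∑< (λ p → ∑ (λ W → mult b W * match B (λ t → cyc W (p + t))) (allBlocks b w)) w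
    ≡⟨ ∑<-cong w position ⟩
  ∑< (λ _ → (2 ^ b) ^ (w ∸ length B)) w
    ≡⟨ ∑<-const _ w ⟩
  w * (2 ^ b) ^ (w ∸ length B)
    ∎
  where
  open ≡-Reasoning
  position : ∀ p → p < w →
    ∑ (λ W → mult b W * match B (λ t → cyc W (p + t))) (allBlocks b w) ≡ (2 ^ b) ^ (w ∸ length B)
  position p p<w = begin
    ∑ (λ W → mult b W * match B (λ t → cyc W (p + t))) (allBlocks b w)
      ≡⟨ cong (λ w → ∑ (λ W → mult b W * match B (λ t → cyc W (p + t))) (allBlocks b w)) (m+[n∸m]≡n p≤w) ⟨
    ∑ (λ W → mult b W * match B (λ t → cyc W (p + t))) (allBlocks b (p + (w ∸ p)))
      ≡⟨ ∑-mult-rotate b p (w ∸ p) B (≤-trans k≤w (≤-reflexive (sym (m∸n+n≡m p≤w)))) ⟩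
    ∑ (λ W → mult b W * match B (nth W)) (allBlocks b (w ∸ p + p))
      ≡⟨ cong (λ w → ∑ (λ W → mult b W * match B (nth W)) (allBlocks b w))
              (trans (m∸n+n≡m p≤w) (sym (m+[n∸m]≡n k≤w))) ⟩
    ∑ (λ W → mult b W * match B (nth W)) (allBlocks b (length B + (w ∸ length B)))
      ≡⟨ ∑-mult-match b (w ∸ length B) B<b ⟩
    (2 ^ b) ^ (w ∸ length B)
      ∎
    where p≤w = <⇒≤ p<w

length-P : ∀ b w → length (P b w) ≡ w * (2 ^ b) ^ w
length-P b w = begin
  length (P b w)                                       ≡⟨ length-concatMap-power (mult b) (allBlocks b w) ⟩
  ∑ (λ W → mult b W * length W) (allBlocks b w)
    ≡⟨ ∑-allBlocks-cong b w (λ W w≡ → trans (cong (mult b W *_) w≡) (cong (_* w) (sym (*-identityʳ (mult b W))))) ⟩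
  ∑ (λ W → mult b W * 1 * w) (allBlocks b w)           ≡⟨ ∑-*ʳ w _ (allBlocks b w) ⟩
  ∑ (λ W → mult b W * 1) (allBlocks b w) * w           ≡⟨ cong (_* w) (∑-mult-1 b w) ⟩
  (2 ^ b) ^ w * w                                      ≡⟨ *-comm _ w ⟩
  w * (2 ^ b) ^ w                                      ∎
  where open ≡-Reasoning

cnt-P : ∀ b w {B f} → All (_< b) B → length B ≤ w → Reads f (P b w) →
        Near (cnt B f (length (P b w))) (w * (2 ^ b) ^ (w ∸ length B)) (suc b ^ w * length B)
cnt-P b w {B} {f} B<b k≤w rd = subst₂ (Near (cnt B f (length (P b w))))
  (∑-mult-cnt-cyc b w B<b k≤w) (cong (_* length B) (length-allBlocks b w))
  (cnt-concatMap-power B (mult b) (allBlocks b w) rd)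

-- Segment boundaries, and the bases and digits inside a segment.

≰5 : ∀ {j} → 5 ≤ j → (suc j ≤ᵇ 5) ≡ false
≰5 {j} 5≤j with suc j ≤ᵇ 5 in eq
... | false = refl
... | true  = contradiction (≤ᵇ⇒≤ (suc j) 5 (subst T (sym eq) _)) (<⇒≱ (s≤s 5≤j))

xs-P : ∀ {j} → 5 ≤ j → xs (suc j) ≡ P (suc j) (suc j * suc j)
xs-P {j} 5≤j = cong (λ c → if c then 0 ∷ 1 ∷ [] else P (suc j) (suc j * suc j)) (≰5 5≤j)

bs-2^ : ∀ {j} → 5 ≤ j → bs (suc j) ≡ 2 ^ suc j
bs-2^ {j} 5≤j = cong (λ c → if c then 2 else 2 ^ suc j) (≰5 5≤j)

ls-2^ : ∀ {j} → 5 ≤ j → ls (suc j) ≡ 2 ^ (4 * (suc j * suc j))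
ls-2^ {j} 5≤j = cong (λ c → if c then 0 else 2 ^ (4 * (suc j * suc j))) (≰5 5≤j)

-- From here on, quantities indexed by j belong to segment i = j + 1.
len : ℕ → ℕ
len j = length (xs (suc j))

len≡ : ∀ {j} → 5 ≤ j → let i = suc j in len j ≡ i * i * (2 ^ i) ^ (i * i)
len≡ {j} 5≤j = trans (cong length (xs-P 5≤j)) (length-P (suc j) (suc j * suc j))

^-positive : ∀ i w → 0 < (2 ^ i) ^ w
^-positive i w = m^n>0 (2 ^ i) {{m^n≢0 2 i}} w

w≤len : ∀ {j} → 5 ≤ j → suc j * suc j ≤ len j
w≤len {j} 5≤j = subst (suc j * suc j ≤_) (sym (len≡ 5≤j))
  (m≤m*n _ ((2 ^ suc j) ^ (suc j * suc j)) {{>-nonZero (^-positive (suc j) (suc j * suc j))}})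

len>0 : ∀ {j} → 5 ≤ j → 0 < len j
len>0 5≤j = <-≤-trans z<s (w≤len 5≤j)

ls>0 : ∀ {j} → 5 ≤ j → 0 < ls (suc j)
ls>0 {j} 5≤j = subst (0 <_) (sym (ls-2^ 5≤j)) (m^n>0 2 (4 * (suc j * suc j)))

L-< : ∀ {j} → 5 ≤ j → L j < L (suc j)
L-< {j} 5≤j = begin-strict
  L j                         <⟨ m<m+n (L j) (*-mono-≤ (ls>0 5≤j) (len>0 5≤j)) ⟩
  L j + ls (suc j) * len j    ∎
  where open ≤-Reasoning

L-mono : ∀ {a b} → a ≤ b → L a ≤ L b
L-mono {a} {b} a≤b = subst (λ b → L a ≤ L b) (m+[n∸m]≡n a≤b) (go (b ∸ a))
  where
  go : ∀ d → L a ≤ L (a + d)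
  go zero    = ≤-reflexive (cong L (sym (+-identityʳ a)))
  go (suc d) = ≤-trans (go d) (≤-trans (m≤m+n _ _) (≤-reflexive (cong L (sym (+-suc a d)))))

-- Every segment from the sixth on is nonempty, so `L` grows by at least 1 there. This bounds the
-- segment number by the position and makes the fuel `n + 6` in `seg` sufficient.
j≤L+5 : ∀ j → j ≤ L j + 5
j≤L+5 zero = z≤n
j≤L+5 (suc j) with 5 ≤? j
... | yes 5≤j = ≤-trans (s≤s (j≤L+5 j)) (+-monoˡ-≤ 5 (L-< 5≤j))
... | no  5≰j = ≤-trans (≰⇒> 5≰j) (m≤n+m 5 _)

-- Invariant: the target `i` stays between `start` and `start + fuel`. Smaller indices fail the
-- test, so the search does not stop early; `i` passes it, so it is not skipped.
search-correct : ∀ n fuel {start i} → start ≤ i → i ≤ start + fuel →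
  (∀ s → s < i → L s < n) → n ≤ L i → search n start fuel ≡ i
search-correct n zero       {start} s≤i i≤s below n≤Li = ≤-antisym s≤i (≤-trans i≤s (≤-reflexive (+-identityʳ start)))
search-correct n (suc fuel) {start} {i} s≤i i≤s+f below n≤Li with n ≤ᵇ L start in eq
... | true  = ≤-antisym s≤i (≮⇒≥ λ s<i → <⇒≱ (below start s<i) (≤ᵇ⇒≤ n (L start) (subst T (sym eq) _)))
... | false = search-correct n fuel
  (≤∧≢⇒< s≤i λ { refl → subst T eq (≤⇒≤ᵇ n≤Li) })
  (≤-trans i≤s+f (≤-reflexive (+-suc start fuel))) below n≤Li

seg≡ : ∀ {j n} → 5 ≤ j → L j < n → n ≤ L (suc j) → seg n ≡ suc j
seg≡ {j} {n} 5≤j Lj<n n≤L = search-correct n (n + 6) (s≤s z≤n) (s≤s j≤n+6)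
  (λ { s (s<s s≤j) → ≤-<-trans (L-mono s≤j) Lj<n }) n≤L
  where
  j≤n+6 : j ≤ n + 6
  j≤n+6 = ≤-trans (j≤L+5 j) (+-mono-≤ (<⇒≤ Lj<n) (n≤1+n 5))

q≡ : ∀ {j n} → 5 ≤ j → L j < n → n ≤ L (suc j) → q n ≡ 2 ^ suc j
q≡ 5≤j Lj<n n≤L = trans (cong bs (seg≡ 5≤j Lj<n n≤L)) (bs-2^ 5≤j)

-- Positions count from 1, so offset `t` of the segment is position `suc (L j + t)`. Once `seg` is
-- known, `E` unfolds to `cyc` and its two subtractions undo this shift.
E≡ : ∀ {j} → 5 ≤ j → ∀ t → t < ls (suc j) * len j → E (suc (L j + t)) ≡ cyc (xs (suc j)) t
E≡ {j} 5≤j t t<ll = trans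
  (cong (λ i → cyc (xs i) (suc (L j + t) ∸ L (i ∸ 1) ∸ 1))
        (seg≡ 5≤j (s≤s (m≤m+n (L j) t)) (≤-trans (≤-reflexive (sym (+-suc (L j) t))) (+-monoʳ-≤ (L j) t<ll))))
  (cong (λ n → cyc (xs (suc j)) (n ∸ 1))
        (trans (cong (_∸ L j) (sym (+-suc (L j) t))) (m+n∸m≡n (L j) (suc t))))

locate : ∀ n → ∃ λ j → 5 ≤ j × L j ≤ n × n < L (suc j)
-- `ls` vanishes at the first five indices, so `L 5` computes to 0 and the first nonempty segment
-- has `j = 5`.
locate zero    = 5 , ≤-refl , z≤n , L-< {5} ≤-refl
locate (suc n) with locate n
... | j , 5≤j , Lj≤n , n<L with m≤n⇒m<n∨m≡n n<L
...   | inj₁ 1+n<L = j , 5≤j , m≤n⇒m≤1+n Lj≤n , 1+n<L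
...   | inj₂ 1+n≡L = suc j , m≤n⇒m≤1+n 5≤j , ≤-reflexive (sym 1+n≡L) ,
                     subst (_< L (suc (suc j))) (sym 1+n≡L) (L-< (m≤n⇒m≤1+n 5≤j))

-- Occurrences in the digit sequence and in a single copy.

match-≡ : ∀ B f → applyUpTo f (length B) ≡ B → match B f ≡ 1
match-≡ []      f eq = refl
match-≡ (c ∷ B) f eq with f≡c , rest ← ∷-injective eq =
  cong₂ _*_ (trans (cong [ c ≟₀₁_] f≡c) (≟₀₁-refl c)) (match-≡ B (f ∘ suc) rest)

match-≢ : ∀ B f → applyUpTo f (length B) ≢ B → match B f ≡ 0
match-≢ []      f neq = contradiction refl neq
match-≢ (c ∷ B) f neq with f 0 ≟ c
... | no  f≢c = cong (_* match B (f ∘ suc)) (≟₀₁-≢ (f≢c ∘ sym))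
... | yes f≡c = trans (cong ([ c ≟₀₁ f 0 ] *_) (match-≢ B (f ∘ suc) (neq ∘ cong₂ _∷_ f≡c)))
                      (*-zeroʳ [ c ≟₀₁ f 0 ])

occursAt-match : ∀ B s → (if occursAt B s then 1 else 0) ≡ match B (λ t → E (s + t))
occursAt-match B s with ≡-dec _≟_ (map (λ t → E (s + t)) (upTo (length B))) B
... | yes eq = sym (match-≡ B _ (trans (sym (map-upTo _ (length B))) eq))
... | no neq = sym (match-≢ B _ (neq ∘ trans (map-upTo _ (length B))))

N-cnt : ∀ B n → N B n ≡ cnt B (λ t → E (suc t)) n
N-cnt B zero    = refl
N-cnt B (suc n) = begin
  (if occursAt B (suc n) then 1 else 0) + N B n
    ≡⟨ cong₂ _+_ (occursAt-match B (suc n)) (N-cnt B n) ⟩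
  match B (λ r → E (suc (n + r))) + cnt B (λ t → E (suc t)) n
    ≡⟨ +-comm _ (cnt B (λ t → E (suc t)) n) ⟩
  cnt B (λ t → E (suc t)) n + match B (λ r → E (suc (n + r)))
    ≡⟨ ∑<-suc _ n ⟨
  cnt B (λ t → E (suc t)) (suc n)
    ∎
  where open ≡-Reasoning

N-+ : ∀ B a n → N B (a + n) ≡ N B a + cnt B (λ t → E (suc (a + t))) n
N-+ B a n = trans (N-cnt B (a + n)) (trans (cnt-+ B (λ t → E (suc t)) a n) (cong (_+ cnt B (λ t → E (suc (a + t))) n) (sym (N-cnt B a))))

-- The main term for one copy of x_i, common to both sides: for k ≤ i² it is the weighted cyclic
-- count of `∑-mult-cnt-cyc` with `b = i` and `w = i * i`, and also `len j` divided by
-- `(2 ^ i) ^ k`.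
expected : ℕ → ℕ → ℕ
expected k j = let i = suc j in i * i * (2 ^ i) ^ (i * i ∸ k)

-- The number of words of length i² over the digits 0, ..., i, with an error of `k` for the run of
-- each.
deviation : ℕ → ℕ → ℕ
deviation k j = let i = suc j in suc i ^ (i * i) * k

copy-fits : ∀ j {t} → t < ls (suc j) → t * len j + len j ≤ ls (suc j) * len j
copy-fits j {t} t<l = ≤-trans (≤-reflexive (+-comm (t * len j) (len j))) (*-monoˡ-≤ (len j) t<l)

Reads-copy : ∀ {j} → 5 ≤ j → ∀ {t} → t < ls (suc j) →
             Reads (λ s → E (suc (L j + t * len j + s))) (xs (suc j))
Reads-copy {j} 5≤j {t} t<l s s<len = begin
  E (suc (L j + t * len j + s))     ≡⟨ cong (E ∘ suc) (+-assoc (L j) (t * len j) s) ⟩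
  E (suc (L j + (t * len j + s)))
    ≡⟨ E≡ 5≤j (t * len j + s) (<-≤-trans (+-monoʳ-< (t * len j) s<len) (copy-fits j t<l)) ⟩
  cyc (xs (suc j)) (t * len j + s)  ≡⟨ cyc-periodic* (xs (suc j)) t s ⟩
  cyc (xs (suc j)) s                ≡⟨ cyc-< (xs (suc j)) s<len ⟩
  nth (xs (suc j)) s                ∎
  where open ≡-Reasoning


cnt-copy : ∀ {j} → 5 ≤ j → ∀ {B} → All (_< suc j) B → length B ≤ suc j * suc j → ∀ {t} → t < ls (suc j) →
           Near (cnt B (λ s → E (suc (L j + t * len j + s))) (len j))
                (expected (length B) j) (deviation (length B) j)
cnt-copy {j} 5≤j {B} B<i k≤w {t} t<l =
  subst (λ X → Near (cnt B f (length X)) (expected (length B) j) (deviation (length B) j)) (sym (xs-P 5≤j))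
    (cnt-P (suc j) (suc j * suc j) B<i k≤w (subst (Reads f) (xs-P 5≤j) (Reads-copy 5≤j t<l)))
  where
  f : ℕ → ℕ
  f s = E (suc (L j + t * len j + s))

-- Validity of the digits.

nth-All : ∀ {p} {Pr : ℕ → Set p} → Pr 0 → ∀ {X} → All Pr X → ∀ t → Pr (nth X t)
-- Beyond the end of a list `nth` returns 0, which is where `Pr 0` enters.
nth-All P0 []         t       = P0
nth-All P0 (px ∷ pxs) zero    = px
nth-All P0 (px ∷ pxs) (suc t) = nth-All P0 pxs t

allBlocks-≤ : ∀ b w → All (All (_≤ b)) (allBlocks b w)
allBlocks-≤ b zero    = [] ∷ []
allBlocks-≤ b (suc w) = All.concat⁺ (All.map⁺ (All.applyUpTo⁺₁ _ (suc b) λ { (s<s d≤b) →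
  All.map⁺ (All.map (d≤b ∷_) (allBlocks-≤ b w)) }))

P-≤ : ∀ b w → All (_≤ b) (P b w)
P-≤ b w = All.concat⁺ (All.map⁺ (All.map (λ {W} W≤b → All.concat⁺ (All.replicate⁺ (mult b W) W≤b)) (allBlocks-≤ b w)))

E≤ : ∀ {j n} → 5 ≤ j → L j < n → n ≤ L (suc j) → E n ≤ suc j
E≤ {j} {n} 5≤j Lj<n n≤L = subst (E n ≤_) (seg≡ 5≤j Lj<n n≤L)
  (nth-All {Pr = _≤ seg n} z≤n (subst (λ i → All (_≤ i) (xs i)) (sym (seg≡ 5≤j Lj<n n≤L)) xs-≤) _)
  where
  xs-≤ : All (_≤ suc j) (xs (suc j))
  xs-≤ = subst (All (_≤ suc j)) (sym (xs-P 5≤j)) (P-≤ (suc j) (suc j * suc j))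

2+n≤2^n : ∀ {n} → 3 ≤ n → 2 + n ≤ 2 ^ n
2+n≤2^n {n} 3≤n = subst (λ n → 2 + n ≤ 2 ^ n) (m∸n+n≡m 3≤n) (go (n ∸ 3))
  where
  go : ∀ d → 2 + (d + 3) ≤ 2 ^ (d + 3)
  go zero    = m≤m+n 5 3
  go (suc d) = ≤-trans (s≤s (go d)) (+-mono-≤ (m^n>0 2 (d + 3)) (m≤m+n _ 0))

-- Digits in segment i are at most i, and i + 2 ≤ 2^i. The margin of two yields both halves of
-- `ValidDigits`, the second one at every position.
E-bound : ∀ n → 2 + E (suc n) ≤ q (suc n)
E-bound n with j , 5≤j , Lj≤n , n<L ← locate n = begin
  2 + E (suc n)   ≤⟨ s≤s (s≤s (E≤ 5≤j (s≤s Lj≤n) n<L)) ⟩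
  2 + suc j       ≤⟨ 2+n≤2^n (≤-trans (m≤m+n 3 2) (m≤n⇒m≤1+n 5≤j)) ⟩
  2 ^ suc j       ≡⟨ q≡ 5≤j (s≤s Lj≤n) n<L ⟨
  q (suc n)       ∎
  where open ≤-Reasoning

validDigits : ValidDigits
validDigits = (λ { (suc n) _ → <-trans (n<1+n _) (E-bound n) })
            , (λ m → suc m , n≤1+n m , λ E≡q-1 → <⇒≢ (∸-monoˡ-≤ 1 (E-bound m)) E≡q-1)

-- Natural numbers and unit fractions as rationals.

⟦_⟧ : ℕ → ℚ
⟦ n ⟧ = ℤ.+ n ℚ./ 1

-- Normalisation by a gcd obstructs computation with variables. The facts below are therefore
-- transported to unnormalised rationals, where they become statements about integers.
toℚᵘ-⟦⟧ : ∀ n → toℚᵘ ⟦ n ⟧ ℚᵘ.≃ mkℚᵘ (ℤ.+ n) 0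
toℚᵘ-⟦⟧ n = ℚ.toℚᵘ-fromℚᵘ (mkℚᵘ (ℤ.+ n) 0)

⟦⟧-+ : ∀ m n → ⟦ m + n ⟧ ≡ ⟦ m ⟧ ℚ.+ ⟦ n ⟧
⟦⟧-+ m n = ℚ.toℚᵘ-injective (begin-equality
  toℚᵘ ⟦ m + n ⟧                          ≃⟨ toℚᵘ-⟦⟧ (m + n) ⟩
  mkℚᵘ (ℤ.+ (m + n)) 0
    ≃⟨ *≡* (cong (ℤ._* ℤ.+ 1) (cong₂ ℤ._+_ (sym (ℤ.*-identityʳ (ℤ.+ m))) (sym (ℤ.*-identityʳ (ℤ.+ n))))) ⟩
  mkℚᵘ (ℤ.+ m) 0 ℚᵘ.+ mkℚᵘ (ℤ.+ n) 0          ≃⟨ ℚᵘ.+-cong (toℚᵘ-⟦⟧ m) (toℚᵘ-⟦⟧ n) ⟨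
  toℚᵘ ⟦ m ⟧ ℚᵘ.+ toℚᵘ ⟦ n ⟧              ≃⟨ ℚ.toℚᵘ-homo-+ ⟦ m ⟧ ⟦ n ⟧ ⟨
  toℚᵘ (⟦ m ⟧ ℚ.+ ⟦ n ⟧)                  ∎)
  where open ℚᵘ.≤-Reasoning

⟦⟧-* : ∀ m n → ⟦ m * n ⟧ ≡ ⟦ m ⟧ ℚ.* ⟦ n ⟧
⟦⟧-* m n = ℚ.toℚᵘ-injective (begin-equality
  toℚᵘ ⟦ m * n ⟧                          ≃⟨ toℚᵘ-⟦⟧ (m * n) ⟩
  mkℚᵘ (ℤ.+ (m * n)) 0                      ≃⟨ *≡* (cong (ℤ._* ℤ.+ 1) (ℤ.pos-* m n)) ⟩
  mkℚᵘ (ℤ.+ m) 0 ℚᵘ.* mkℚᵘ (ℤ.+ n) 0          ≃⟨ ℚᵘ.*-cong (toℚᵘ-⟦⟧ m) (toℚᵘ-⟦⟧ n) ⟨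
  toℚᵘ ⟦ m ⟧ ℚᵘ.* toℚᵘ ⟦ n ⟧              ≃⟨ ℚ.toℚᵘ-homo-* ⟦ m ⟧ ⟦ n ⟧ ⟨
  toℚᵘ (⟦ m ⟧ ℚ.* ⟦ n ⟧)                  ∎)
  where open ℚᵘ.≤-Reasoning

⟦⟧-mono-≤ : ∀ {m n} → m ≤ n → ⟦ m ⟧ ℚ.≤ ⟦ n ⟧
⟦⟧-mono-≤ {m} {n} m≤n = ℚ.toℚᵘ-cancel-≤ (begin
  toℚᵘ ⟦ m ⟧     ≃⟨ toℚᵘ-⟦⟧ m ⟩
  mkℚᵘ (ℤ.+ m) 0   ≤⟨ *≤* (ℤ.*-monoʳ-≤-nonNeg (ℤ.+ 1) (ℤ.+≤+ m≤n)) ⟩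
  mkℚᵘ (ℤ.+ n) 0   ≃⟨ toℚᵘ-⟦⟧ n ⟨
  toℚᵘ ⟦ n ⟧     ∎)
  where open ℚᵘ.≤-Reasoning

⟦⟧-mono-< : ∀ {m n} → m < n → ⟦ m ⟧ ℚ.< ⟦ n ⟧
⟦⟧-mono-< {m} {n} m<n = ℚ.toℚᵘ-cancel-< (begin-strict
  toℚᵘ ⟦ m ⟧     ≃⟨ toℚᵘ-⟦⟧ m ⟩
  mkℚᵘ (ℤ.+ m) 0   <⟨ ℚᵘ.*<* (ℤ.*-monoʳ-<-pos (ℤ.+ 1) (ℤ.+<+ m<n)) ⟩
  mkℚᵘ (ℤ.+ n) 0   ≃⟨ toℚᵘ-⟦⟧ n ⟨
  toℚᵘ ⟦ n ⟧     ∎)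
  where open ℚᵘ.≤-Reasoning

0≤⟦⟧ : ∀ n → 0ℚ ℚ.≤ ⟦ n ⟧
0≤⟦⟧ n = ⟦⟧-mono-≤ {0} {n} z≤n

infix 8 1/_
1/_ : (d : ℕ) .{{_ : NonZero d}} → ℚ
1/ d = ℤ.+ 1 ℚ./ d

1/-inverseʳ : ∀ d .{{_ : NonZero d}} → ⟦ d ⟧ ℚ.* 1/ d ≡ 1ℚ
1/-inverseʳ (suc d) = ℚ.toℚᵘ-injective (begin-equality
  toℚᵘ (⟦ suc d ⟧ ℚ.* 1/ suc d)             ≃⟨ ℚ.toℚᵘ-homo-* ⟦ suc d ⟧ (1/ suc d) ⟩
  toℚᵘ ⟦ suc d ⟧ ℚᵘ.* toℚᵘ (1/ suc d)       ≃⟨ ℚᵘ.*-cong (toℚᵘ-⟦⟧ (suc d)) (ℚ.toℚᵘ-fromℚᵘ (mkℚᵘ (ℤ.+ 1) d)) ⟩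
  mkℚᵘ (ℤ.+ suc d) 0 ℚᵘ.* mkℚᵘ (ℤ.+ 1) d
    ≃⟨ *≡* (trans (ℤ.*-identityʳ _) (trans (ℤ.*-identityʳ (ℤ.+ suc d)) (sym (trans (ℤ.*-identityˡ _) (ℤ.*-identityˡ _))))) ⟩
  ℚᵘ.1ℚᵘ                                    ∎)
  where open ℚᵘ.≤-Reasoning

0≤1/ : ∀ d .{{_ : NonZero d}} → 0ℚ ℚ.≤ 1/ d
0≤1/ (suc d) = ℚ.toℚᵘ-cancel-≤ (begin
  ℚᵘ.0ℚᵘ            ≤⟨ *≤* (ℤ.+≤+ z≤n) ⟩
  mkℚᵘ (ℤ.+ 1) d      ≃⟨ ℚ.toℚᵘ-fromℚᵘ (mkℚᵘ (ℤ.+ 1) d) ⟨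
  toℚᵘ (1/ suc d)   ∎)
  where open ℚᵘ.≤-Reasoning

1/≤1 : ∀ d .{{_ : NonZero d}} → 1/ d ℚ.≤ 1ℚ
1/≤1 (suc d) = ℚ.toℚᵘ-cancel-≤ (begin
  toℚᵘ (1/ suc d)   ≃⟨ ℚ.toℚᵘ-fromℚᵘ (mkℚᵘ (ℤ.+ 1) d) ⟩
  mkℚᵘ (ℤ.+ 1) d      ≤⟨ *≤* (ℤ.+≤+ (s≤s z≤n)) ⟩
  ℚᵘ.1ℚᵘ            ∎)
  where open ℚᵘ.≤-Reasoning

-- The witness is the denominator of `ε`: multiplying by it leaves the numerator, a positive
-- integer.
archimedean : ∀ ε → 0ℚ ℚ.< ε → ∃ λ d → 1 ≤ d × 1ℚ ℚ.≤ ε ℚ.* ⟦ d ⟧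
archimedean (mkℚ (ℤ.+ 0) d-1 _) (ℚ.*<* (ℤ.+<+ ()))
archimedean (mkℚ ℤ.-[1+ _ ] d-1 _) (ℚ.*<* ())
archimedean ε@(mkℚ +[1+ p ] d-1 _) _ = suc d-1 , s≤s z≤n , ℚ.toℚᵘ-cancel-≤ (begin
  ℚᵘ.1ℚᵘ                                      ≤⟨ *≤* (ℤ.+≤+ le) ⟩
  mkℚᵘ +[1+ p ] d-1 ℚᵘ.* mkℚᵘ (ℤ.+ suc d-1) 0   ≃⟨ ℚᵘ.*-congˡ {toℚᵘ ε} (toℚᵘ-⟦⟧ (suc d-1)) ⟨
  toℚᵘ ε ℚᵘ.* toℚᵘ ⟦ suc d-1 ⟧                ≃⟨ ℚ.toℚᵘ-homo-* ε ⟦ suc d-1 ⟧ ⟨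
  toℚᵘ (ε ℚ.* ⟦ suc d-1 ⟧)                    ∎)
  where
  open ℚᵘ.≤-Reasoning
  le : 1 * (suc d-1 * 1) ≤ suc p * suc d-1 * 1
  le = ≤-trans (≤-reflexive (*-identityˡ _)) (*-monoˡ-≤ 1 (m≤n*m (suc d-1) (suc p)))

-- Approximate increments, and the quotient of two close quantities.

record Step (x y : ℚ) (g R : ℕ) : Set where
  constructor step
  field
    -- Together the two bounds say |(y - x) - g| ≤ R. This is the counterpart of `Near` for an
    -- increment, so that consecutive increments compose.
    upper : y ℚ.≤ x ℚ.+ ⟦ g + R ⟧
    lower : x ℚ.+ ⟦ g ⟧ ℚ.≤ y ℚ.+ ⟦ R ⟧

Step-trans : ∀ {x y z g R g′ R′} → Step x y g R → Step y z g′ R′ → Step x z (g + g′) (R + R′)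
Step-trans {x} {y} {z} {g} {R} {g′} {R′} (step u l) (step u′ l′) = step
  (begin
    z                                     ≤⟨ u′ ⟩
    y ℚ.+ ⟦ g′ + R′ ⟧                     ≤⟨ ℚ.+-monoˡ-≤ ⟦ g′ + R′ ⟧ u ⟩
    x ℚ.+ ⟦ g + R ⟧ ℚ.+ ⟦ g′ + R′ ⟧       ≡⟨ ℚ.+-assoc x _ _ ⟩
    x ℚ.+ (⟦ g + R ⟧ ℚ.+ ⟦ g′ + R′ ⟧)     ≡⟨ cong (x ℚ.+_) (⟦⟧-+ (g + R) (g′ + R′)) ⟨
    x ℚ.+ ⟦ g + R + (g′ + R′) ⟧           ≡⟨ cong (λ n → x ℚ.+ ⟦ n ⟧) (+-interchange g R g′ R′) ⟩
    x ℚ.+ ⟦ g + g′ + (R + R′) ⟧           ∎)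
  (begin
    x ℚ.+ ⟦ g + g′ ⟧            ≡⟨ cong (x ℚ.+_) (⟦⟧-+ g g′) ⟩
    x ℚ.+ (⟦ g ⟧ ℚ.+ ⟦ g′ ⟧)    ≡⟨ ℚ.+-assoc x _ _ ⟨
    x ℚ.+ ⟦ g ⟧ ℚ.+ ⟦ g′ ⟧      ≤⟨ ℚ.+-monoˡ-≤ ⟦ g′ ⟧ l ⟩
    y ℚ.+ ⟦ R ⟧ ℚ.+ ⟦ g′ ⟧      ≡⟨ swap y ⟦ R ⟧ ⟦ g′ ⟧ ⟩
    y ℚ.+ ⟦ g′ ⟧ ℚ.+ ⟦ R ⟧      ≤⟨ ℚ.+-monoˡ-≤ ⟦ R ⟧ l′ ⟩
    z ℚ.+ ⟦ R′ ⟧ ℚ.+ ⟦ R ⟧      ≡⟨ swap z ⟦ R′ ⟧ ⟦ R ⟧ ⟩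
    z ℚ.+ ⟦ R ⟧ ℚ.+ ⟦ R′ ⟧      ≡⟨ ℚ.+-assoc z _ _ ⟩
    z ℚ.+ (⟦ R ⟧ ℚ.+ ⟦ R′ ⟧)    ≡⟨ cong (z ℚ.+_) (⟦⟧-+ R R′) ⟨
    z ℚ.+ ⟦ R + R′ ⟧            ∎)
  where
  open ℚ.≤-Reasoning
  swap : ∀ a b c → a ℚ.+ b ℚ.+ c ≡ a ℚ.+ c ℚ.+ b
  swap = solve 3 (λ a b c → a :+ b :+ c := a :+ c :+ b) refl

Step-refl : ∀ x → Step x x 0 0
Step-refl x = step (ℚ.≤-reflexive (sym (ℚ.+-identityʳ x))) ℚ.≤-refl

Step-weaken : ∀ {x y g R R′} → R ≤ R′ → Step x y g R → Step x y g R′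
Step-weaken {x} {y} {g} R≤R′ (step u l) = step
  (ℚ.≤-trans u (ℚ.+-monoʳ-≤ x (⟦⟧-mono-≤ (+-monoʳ-≤ g R≤R′))))
  (ℚ.≤-trans l (ℚ.+-monoʳ-≤ y (⟦⟧-mono-≤ R≤R′)))

Near⇒Step : ∀ a {c g R} → Near c g R → Step ⟦ a ⟧ ⟦ a + c ⟧ g R
Near⇒Step a {c} {g} {R} (near u l) = step
  (ℚ.≤-trans (⟦⟧-mono-≤ (+-monoʳ-≤ a u)) (ℚ.≤-reflexive (⟦⟧-+ a (g + R))))
  (begin
    ⟦ a ⟧ ℚ.+ ⟦ g ⟧     ≡⟨ ⟦⟧-+ a g ⟨
    ⟦ a + g ⟧           ≤⟨ ⟦⟧-mono-≤ (≤-trans (+-monoʳ-≤ a l) (≤-reflexive (sym (+-assoc a c R)))) ⟩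
    ⟦ a + c + R ⟧       ≡⟨ ⟦⟧-+ (a + c) R ⟩
    ⟦ a + c ⟧ ℚ.+ ⟦ R ⟧ ∎)
  where open ℚ.≤-Reasoning

∣-∣≤ : ∀ {x y r} → x ℚ.≤ y ℚ.+ r → y ℚ.≤ x ℚ.+ r → ℚ.∣ x ℚ.- y ∣ ℚ.≤ r
∣-∣≤ {x} {y} {r} x≤y+r y≤x+r with ℚ.∣p∣≡p∨∣p∣≡-p (x ℚ.- y)
... | inj₁ eq = begin
  ℚ.∣ x ℚ.- y ∣      ≡⟨ eq ⟩
  x ℚ.- y            ≤⟨ ℚ.+-monoˡ-≤ (ℚ.- y) x≤y+r ⟩
  y ℚ.+ r ℚ.- y      ≡⟨ solve 2 (λ y r → y :+ r :- y := r) refl y r ⟩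
  r                  ∎
  where open ℚ.≤-Reasoning
... | inj₂ eq = begin
  ℚ.∣ x ℚ.- y ∣      ≡⟨ eq ⟩
  ℚ.- (x ℚ.- y)      ≡⟨ solve 2 (λ x y → :- (x :- y) := y :- x) refl x y ⟩
  y ℚ.- x            ≤⟨ ℚ.+-monoˡ-≤ (ℚ.- x) y≤x+r ⟩
  x ℚ.+ r ℚ.- x      ≡⟨ solve 2 (λ y r → y :+ r :- y := r) refl x r ⟩
  r                  ∎
  where open ℚ.≤-Reasoning

-- Both x and y are within R of g, so |x - y| ≤ 2R < 3R ≤ ε d 3R ≤ ε y, the last because y ≥ g - R ≥
-- 3dR. The 1 in `1 + d * 3` pays for the subtracted R; the 3 instead of 2 gives strictness, as R ≥
-- 1.
ratio-near-1 : ∀ {x y d g R ε} → 0ℚ ℚ.< ε → 1 ≤ d → 1ℚ ℚ.≤ ε ℚ.* ⟦ d ⟧ → 1 ≤ R → (1 + d * 3) * R ≤ g →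
               Step 0ℚ x g R → Step 0ℚ y g R → ℚ.∣ ratio x y ℚ.- 1ℚ ∣ ℚ.< ε
ratio-near-1 {x} {y} {d} {g} {R} {ε} 0<ε 1≤d 1≤εd 1≤R dR≤g (step ux lx) (step uy ly) = go
  where
  open ℚ.≤-Reasoning

  y≥ : ⟦ d * 3 * R ⟧ ℚ.≤ y
  y≥ = begin
    ⟦ d * 3 * R ⟧                        ≡⟨ cancel ⟦ d * 3 * R ⟧ ⟦ R ⟧ ⟨
    ⟦ R ⟧ ℚ.+ ⟦ d * 3 * R ⟧ ℚ.- ⟦ R ⟧    ≡⟨ cong (ℚ._- ⟦ R ⟧) (⟦⟧-+ R (d * 3 * R)) ⟨
    ⟦ (1 + d * 3) * R ⟧ ℚ.- ⟦ R ⟧        ≤⟨ ℚ.+-monoˡ-≤ (ℚ.- ⟦ R ⟧) (⟦⟧-mono-≤ dR≤g) ⟩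
    ⟦ g ⟧ ℚ.- ⟦ R ⟧                      ≡⟨ cong (ℚ._- ⟦ R ⟧) (ℚ.+-identityˡ ⟦ g ⟧) ⟨
    0ℚ ℚ.+ ⟦ g ⟧ ℚ.- ⟦ R ⟧               ≤⟨ ℚ.+-monoˡ-≤ (ℚ.- ⟦ R ⟧) ly ⟩
    y ℚ.+ ⟦ R ⟧ ℚ.- ⟦ R ⟧                ≡⟨ cong (ℚ._- ⟦ R ⟧) (ℚ.+-comm y ⟦ R ⟧) ⟩
    ⟦ R ⟧ ℚ.+ y ℚ.- ⟦ R ⟧                ≡⟨ cancel y ⟦ R ⟧ ⟩
    y                                    ∎
    where
    cancel : ∀ a b → b ℚ.+ a ℚ.- b ≡ a
    cancel = solve 2 (λ a b → b :+ a :- b := a) refl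

  0<y : 0ℚ ℚ.< y
  0<y = ℚ.<-≤-trans (⟦⟧-mono-< {0} (*-mono-≤ (*-mono-≤ 1≤d (s≤s (z≤n {2}))) 1≤R)) y≥

  close : ∀ {x y} → x ℚ.≤ 0ℚ ℚ.+ ⟦ g + R ⟧ → 0ℚ ℚ.+ ⟦ g ⟧ ℚ.≤ y ℚ.+ ⟦ R ⟧ → x ℚ.≤ y ℚ.+ ⟦ R + R ⟧
  close {x} {y} ux ly = begin
    x                                ≤⟨ ux ⟩
    0ℚ ℚ.+ ⟦ g + R ⟧                 ≡⟨ cong (0ℚ ℚ.+_) (⟦⟧-+ g R) ⟩
    0ℚ ℚ.+ (⟦ g ⟧ ℚ.+ ⟦ R ⟧)         ≡⟨ ℚ.+-assoc 0ℚ ⟦ g ⟧ ⟦ R ⟧ ⟨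
    0ℚ ℚ.+ ⟦ g ⟧ ℚ.+ ⟦ R ⟧           ≤⟨ ℚ.+-monoˡ-≤ ⟦ R ⟧ ly ⟩
    y ℚ.+ ⟦ R ⟧ ℚ.+ ⟦ R ⟧            ≡⟨ ℚ.+-assoc y ⟦ R ⟧ ⟦ R ⟧ ⟩
    y ℚ.+ (⟦ R ⟧ ℚ.+ ⟦ R ⟧)          ≡⟨ cong (y ℚ.+_) (⟦⟧-+ R R) ⟨
    y ℚ.+ ⟦ R + R ⟧                  ∎

  ∣x-y∣< : ℚ.∣ x ℚ.- y ∣ ℚ.< ε ℚ.* y
  ∣x-y∣< = begin-strict
    ℚ.∣ x ℚ.- y ∣                       ≤⟨ ∣-∣≤ (close {x} {y} ux ly) (close {y} {x} uy lx) ⟩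
    ⟦ R + R ⟧                           <⟨ ⟦⟧-mono-< (+-monoʳ-< R (m<m+n R (≤-trans 1≤R (m≤m+n R 0)))) ⟩
    ⟦ 3 * R ⟧                           ≡⟨ ℚ.*-identityˡ ⟦ 3 * R ⟧ ⟨
    1ℚ ℚ.* ⟦ 3 * R ⟧                    ≤⟨ ℚ.*-monoʳ-≤-nonNeg ⟦ 3 * R ⟧ {{ℚ.nonNegative (0≤⟦⟧ (3 * R))}} 1≤εd ⟩
    ε ℚ.* ⟦ d ⟧ ℚ.* ⟦ 3 * R ⟧           ≡⟨ ℚ.*-assoc ε ⟦ d ⟧ ⟦ 3 * R ⟧ ⟩
    ε ℚ.* (⟦ d ⟧ ℚ.* ⟦ 3 * R ⟧)         ≡⟨ cong (ε ℚ.*_) (⟦⟧-* d (3 * R)) ⟨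
    ε ℚ.* ⟦ d * (3 * R) ⟧               ≡⟨ cong (λ n → ε ℚ.* ⟦ n ⟧) (*-assoc d 3 R) ⟨
    ε ℚ.* ⟦ d * 3 * R ⟧                 ≤⟨ ℚ.*-monoˡ-≤-nonNeg ε {{ℚ.nonNegative (ℚ.<⇒≤ 0<ε)}} y≥ ⟩
    ε ℚ.* y                             ∎

  go : ℚ.∣ ratio x y ℚ.- 1ℚ ∣ ℚ.< ε
  go with y ℚ.≟ 0ℚ
  -- Positivity of `y` excludes the default value of `ratio`.
  ... | yes y≡0 = contradiction 0<y (ℚ.<-irrefl (sym y≡0))
  ... | no  y≢0 = ℚ.*-cancelʳ-<-nonNeg y {{ℚ.nonNegative (ℚ.<⇒≤ 0<y)}} (begin-strict
    ℚ.∣ p ∣ ℚ.* y             ≡⟨ cong (ℚ.∣ p ∣ ℚ.*_) (ℚ.0≤p⇒∣p∣≡p (ℚ.<⇒≤ 0<y)) ⟨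
    ℚ.∣ p ∣ ℚ.* ℚ.∣ y ∣       ≡⟨ ℚ.∣p*q∣≡∣p∣*∣q∣ p y ⟨
    ℚ.∣ p ℚ.* y ∣             ≡⟨ cong ℚ.∣_∣ p*y≡ ⟩
    ℚ.∣ x ℚ.- y ∣             <⟨ ∣x-y∣< ⟩
    ε ℚ.* y                   ∎)
    where
    instance
      y-nonZero : ℚ.NonZero y
      y-nonZero = ℚ.≢-nonZero y≢0
    p = x ℚ.÷ y ℚ.- 1ℚ
    p*y≡ : p ℚ.* y ≡ x ℚ.- y
    p*y≡ = begin-equality
      (x ℚ.* ℚ.1/ y ℚ.- 1ℚ) ℚ.* y                  ≡⟨ ℚ.*-distribʳ-+ y (x ℚ.* ℚ.1/ y) (ℚ.- 1ℚ) ⟩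
      x ℚ.* ℚ.1/ y ℚ.* y ℚ.+ (ℚ.- 1ℚ) ℚ.* y
        ≡⟨ cong₂ ℚ._+_ (ℚ.*-assoc x (ℚ.1/ y) y) (sym (ℚ.neg-distribˡ-* 1ℚ y)) ⟩
      x ℚ.* (ℚ.1/ y ℚ.* y) ℚ.- 1ℚ ℚ.* y
        ≡⟨ cong₂ (λ a b → x ℚ.* a ℚ.- b) (ℚ.*-inverseˡ y) (ℚ.*-identityˡ y) ⟩
      x ℚ.* 1ℚ ℚ.- y                               ≡⟨ cong (ℚ._- y) (ℚ.*-identityʳ x) ⟩
      x ℚ.- y                                      ∎

-- Growth of the counts and of Q^(k) over runs of positions.

UnitSteps : (ℕ → ℚ) → Set
-- The change per position is at most 1 in absolute value. This controls the positions outside the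
-- complete copies, for both sequences.
UnitSteps X = ∀ n → Step (X n) (X (suc n)) 0 1

Step-unit : ∀ x {τ} → 0ℚ ℚ.≤ τ → τ ℚ.≤ 1ℚ → Step x (x ℚ.+ τ) 0 1
Step-unit x {τ} 0≤τ τ≤1 = step (ℚ.+-monoʳ-≤ x τ≤1) (begin
  x ℚ.+ 0ℚ          ≤⟨ ℚ.+-monoʳ-≤ x 0≤τ ⟩
  x ℚ.+ τ           ≡⟨ ℚ.+-identityʳ (x ℚ.+ τ) ⟨
  x ℚ.+ τ ℚ.+ 0ℚ    ≤⟨ ℚ.+-monoʳ-≤ (x ℚ.+ τ) (0≤⟦⟧ 1) ⟩
  x ℚ.+ τ ℚ.+ 1ℚ    ∎)
  where open ℚ.≤-Reasoning

drift : ∀ {X} → UnitSteps X → ∀ a r → Step (X a) (X (a + r)) 0 r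
drift {X} us a zero    = subst (λ n → Step (X a) (X n) 0 0) (sym (+-identityʳ a)) (Step-refl (X a))
drift {X} us a (suc r) = subst (λ n → Step (X a) (X n) 0 (suc r)) (sym (+-suc a r))
  (Step-trans (us a) (drift us (suc a) r))

Q-unitSteps : ∀ k → UnitSteps (λ n → Qk n k)
Q-unitSteps k n = Step-unit (Qk n k) (0≤1/ (qprod (suc n) k) {{qprod-nz (suc n) k}})
                                     (1/≤1 (qprod (suc n) k) {{qprod-nz (suc n) k}})

N-step : ∀ B a n {g R} → Near (cnt B (λ t → E (suc (a + t))) n) g R →
         Step ⟦ N B a ⟧ ⟦ N B (a + n) ⟧ g R
N-step B a n {g} {R} nr = subst (λ m → Step ⟦ N B a ⟧ ⟦ m ⟧ g R) (sym (N-+ B a n)) (Near⇒Step (N B a) nr)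

N-unitSteps : ∀ B → UnitSteps (λ n → ⟦ N B n ⟧)
N-unitSteps B n = subst (λ m → Step ⟦ N B n ⟧ ⟦ N B m ⟧ 0 1) (+-comm n 1)
  (N-step B n 1 (near (cnt≤ B (λ t → E (suc (n + t))) 1) z≤n))

module _ {k a n d : ℕ} .{{_ : NonZero d}} (q≡d : ∀ t → t < n → qprod (suc (a + t)) k ≡ d) where

  1/-cong : ∀ {m} .{{_ : NonZero m}} → m ≡ d → 1/ m ≡ 1/ d
  1/-cong refl = refl

  Qk-run : ∀ m → m ≤ n → Qk (a + m) k ≡ Qk a k ℚ.+ ⟦ m ⟧ ℚ.* 1/ d
  Qk-run zero    m≤n = trans (cong (λ m → Qk m k) (+-identityʳ a))
    (sym (trans (cong (Qk a k ℚ.+_) (ℚ.*-zeroˡ (1/ d))) (ℚ.+-identityʳ (Qk a k))))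
  Qk-run (suc m) m<n = begin
    Qk (a + suc m) k
      ≡⟨ cong (λ m → Qk m k) (+-suc a m) ⟩
    Qk (a + m) k ℚ.+ (1/ qprod (suc (a + m)) k) {{qprod-nz (suc (a + m)) k}}
      ≡⟨ cong₂ ℚ._+_ (Qk-run m (<⇒≤ m<n)) (1/-cong {{qprod-nz (suc (a + m)) k}} (q≡d m m<n)) ⟩
    Qk a k ℚ.+ ⟦ m ⟧ ℚ.* 1/ d ℚ.+ 1/ d
      ≡⟨ lemma (Qk a k) ⟦ m ⟧ (1/ d) ⟩
    Qk a k ℚ.+ (1ℚ ℚ.+ ⟦ m ⟧) ℚ.* 1/ d
      ≡⟨ cong (λ x → Qk a k ℚ.+ x ℚ.* 1/ d) (⟦⟧-+ 1 m) ⟨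
    Qk a k ℚ.+ ⟦ suc m ⟧ ℚ.* 1/ d
      ∎
    where
    open ≡-Reasoning
    lemma : ∀ x y z → x ℚ.+ y ℚ.* z ℚ.+ z ≡ x ℚ.+ (1ℚ ℚ.+ y) ℚ.* z
    lemma = solve 3 (λ x y z → x :+ y :* z :+ z := x :+ (con 1ℚ :+ y) :* z) refl

  -- The `n` regular positions contribute n/d = g - r/d, where 0 ≤ r/d ≤ r. The remaining `r`
  -- positions, whose products may reach beyond the region where they equal `d`, cost at most `r`
  -- more; hence `r + r`.
  Q-step : ∀ {g r} → g * d ≡ n + r → Step (Qk a k) (Qk (a + (n + r)) k) g (r + r)
  Q-step {g} {r} gd≡ = subst₂ (λ m h → Step (Qk a k) (Qk m k) h (r + r)) (+-assoc a n r) (+-identityʳ g)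
    (Step-trans (step upper lower) (drift (Q-unitSteps k) (a + n) r))
    where
    open ℚ.≤-Reasoning
    instance
      0≤d⁻¹ : ℚ.NonNegative (1/ d)
      0≤d⁻¹ = ℚ.nonNegative (0≤1/ d)
    g≡ : ⟦ g ⟧ ≡ ⟦ n ⟧ ℚ.* 1/ d ℚ.+ ⟦ r ⟧ ℚ.* 1/ d
    g≡ = begin-equality
      ⟦ g ⟧                                  ≡⟨ ℚ.*-identityʳ ⟦ g ⟧ ⟨
      ⟦ g ⟧ ℚ.* 1ℚ                           ≡⟨ cong (⟦ g ⟧ ℚ.*_) (1/-inverseʳ d) ⟨
      ⟦ g ⟧ ℚ.* (⟦ d ⟧ ℚ.* 1/ d)             ≡⟨ ℚ.*-assoc ⟦ g ⟧ ⟦ d ⟧ (1/ d) ⟨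
      ⟦ g ⟧ ℚ.* ⟦ d ⟧ ℚ.* 1/ d               ≡⟨ cong (ℚ._* 1/ d) (⟦⟧-* g d) ⟨
      ⟦ g * d ⟧ ℚ.* 1/ d                     ≡⟨ cong (λ m → ⟦ m ⟧ ℚ.* 1/ d) gd≡ ⟩
      ⟦ n + r ⟧ ℚ.* 1/ d                     ≡⟨ cong (ℚ._* 1/ d) (⟦⟧-+ n r) ⟩
      (⟦ n ⟧ ℚ.+ ⟦ r ⟧) ℚ.* 1/ d             ≡⟨ ℚ.*-distribʳ-+ (1/ d) ⟦ n ⟧ ⟦ r ⟧ ⟩
      ⟦ n ⟧ ℚ.* 1/ d ℚ.+ ⟦ r ⟧ ℚ.* 1/ d      ∎
    0≤r/d : 0ℚ ℚ.≤ ⟦ r ⟧ ℚ.* 1/ d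
    0≤r/d = begin
      0ℚ                 ≡⟨ ℚ.*-zeroˡ (1/ d) ⟨
      0ℚ ℚ.* 1/ d        ≤⟨ ℚ.*-monoʳ-≤-nonNeg (1/ d) (0≤⟦⟧ r) ⟩
      ⟦ r ⟧ ℚ.* 1/ d     ∎
    r/d≤r : ⟦ r ⟧ ℚ.* 1/ d ℚ.≤ ⟦ r ⟧
    r/d≤r = begin
      ⟦ r ⟧ ℚ.* 1/ d     ≤⟨ ℚ.*-monoˡ-≤-nonNeg ⟦ r ⟧ {{ℚ.nonNegative (0≤⟦⟧ r)}} (1/≤1 d) ⟩
      ⟦ r ⟧ ℚ.* 1ℚ       ≡⟨ ℚ.*-identityʳ ⟦ r ⟧ ⟩
      ⟦ r ⟧              ∎
    upper : Qk (a + n) k ℚ.≤ Qk a k ℚ.+ ⟦ g + r ⟧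
    upper = begin
      Qk (a + n) k                                         ≡⟨ Qk-run n ≤-refl ⟩
      Qk a k ℚ.+ ⟦ n ⟧ ℚ.* 1/ d
        ≡⟨ cong (Qk a k ℚ.+_) (ℚ.+-identityʳ (⟦ n ⟧ ℚ.* 1/ d)) ⟨
      Qk a k ℚ.+ (⟦ n ⟧ ℚ.* 1/ d ℚ.+ 0ℚ)
        ≤⟨ ℚ.+-monoʳ-≤ (Qk a k) (ℚ.+-monoʳ-≤ (⟦ n ⟧ ℚ.* 1/ d) 0≤r/d) ⟩
      Qk a k ℚ.+ (⟦ n ⟧ ℚ.* 1/ d ℚ.+ ⟦ r ⟧ ℚ.* 1/ d)       ≡⟨ cong (Qk a k ℚ.+_) g≡ ⟨
      Qk a k ℚ.+ ⟦ g ⟧                                     ≤⟨ ℚ.+-monoʳ-≤ (Qk a k) (⟦⟧-mono-≤ (m≤m+n g r)) ⟩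
      Qk a k ℚ.+ ⟦ g + r ⟧                                 ∎
    lower : Qk a k ℚ.+ ⟦ g ⟧ ℚ.≤ Qk (a + n) k ℚ.+ ⟦ r ⟧
    lower = begin
      Qk a k ℚ.+ ⟦ g ⟧                                     ≡⟨ cong (Qk a k ℚ.+_) g≡ ⟩
      Qk a k ℚ.+ (⟦ n ⟧ ℚ.* 1/ d ℚ.+ ⟦ r ⟧ ℚ.* 1/ d)
        ≤⟨ ℚ.+-monoʳ-≤ (Qk a k) (ℚ.+-monoʳ-≤ (⟦ n ⟧ ℚ.* 1/ d) r/d≤r) ⟩
      Qk a k ℚ.+ (⟦ n ⟧ ℚ.* 1/ d ℚ.+ ⟦ r ⟧)                ≡⟨ ℚ.+-assoc (Qk a k) (⟦ n ⟧ ℚ.* 1/ d) ⟦ r ⟧ ⟨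
      Qk a k ℚ.+ ⟦ n ⟧ ℚ.* 1/ d ℚ.+ ⟦ r ⟧                  ≡⟨ cong (ℚ._+ ⟦ r ⟧) (Qk-run n ≤-refl) ⟨
      Qk (a + n) k ℚ.+ ⟦ r ⟧                               ∎

-- The last factor of `qprod s k` has index s + k - 1, so the bound `suc (L (suc j))` keeps all
-- factors inside the segment.
qprod≡ : ∀ {j} → 5 ≤ j → ∀ k {s} → L j < s → s + k ≤ suc (L (suc j)) → qprod s k ≡ (2 ^ suc j) ^ k
qprod≡ 5≤j zero        Lj<s s+k≤L = refl
qprod≡ 5≤j (suc k) {s} Lj<s s+k≤L = cong₂ _*_
  (q≡ 5≤j Lj<s (≤-trans (m≤m+n s k) (s≤s⁻¹ s+1+k≤L)))
  (qprod≡ 5≤j k (m<n⇒m<1+n Lj<s) s+1+k≤L)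
  where
  s+1+k≤L = ≤-trans (≤-reflexive (sym (+-suc s k))) s+k≤L

-- From copies to segments and arbitrary prefixes.

CopySteps : (ℕ → ℚ) → ℕ → ℕ → Set
-- One interface for both sequences, with the same main term and the same error, so that the
-- summation over copies and segments is carried out once for an abstract `X`.
CopySteps X k j = ∀ t → t < ls (suc j) →
  Step (X (L j + t * len j)) (X (L j + t * len j + len j)) (expected k j) (deviation k j)

N-copySteps : ∀ {j} → 5 ≤ j → ∀ {B} → All (_< suc j) B → length B ≤ suc j * suc j →
              CopySteps (λ n → ⟦ N B n ⟧) (length B) j
N-copySteps {j} 5≤j {B} B<i k≤w t t<l = N-step B (L j + t * len j) (len j) (cnt-copy 5≤j B<i k≤w t<l)

-- `len j` is exactly `expected k j` times `(2 ^ i) ^ k`. Products starting at the first `len j ∸ k`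
-- positions stay inside the copy; the other `k` positions are the `r` of `Q-step`. The resulting
-- error 2k is enlarged to the one valid for `N`.
Q-copySteps : ∀ {j} → 5 ≤ j → ∀ k → k ≤ suc j * suc j → CopySteps (λ n → Qk n k) k j
Q-copySteps {j} 5≤j k k≤w t t<l = Step-weaken 2k≤dev
  (subst (λ m → Step (Qk a k) (Qk (a + m) k) (expected k j) (k + k)) n+k≡len
    (Q-step {k} {a} {{m^n≢0 (2 ^ i) k {{m^n≢0 2 i}}}} run (trans expected*d (sym n+k≡len))))
  where
  i = suc j
  w = i * i
  a = L j + t * len j
  n = len j ∸ k
  n+k≡len : n + k ≡ len j
  n+k≡len = m∸n+n≡m (≤-trans k≤w (w≤len 5≤j))
  expected*d : expected k j * (2 ^ i) ^ k ≡ len j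
  expected*d = begin
    w * (2 ^ i) ^ (w ∸ k) * (2 ^ i) ^ k      ≡⟨ *-assoc w ((2 ^ i) ^ (w ∸ k)) ((2 ^ i) ^ k) ⟩
    w * ((2 ^ i) ^ (w ∸ k) * (2 ^ i) ^ k)    ≡⟨ cong (w *_) (^-distribˡ-+-* (2 ^ i) (w ∸ k) k) ⟨
    w * (2 ^ i) ^ (w ∸ k + k)                ≡⟨ cong (λ m → w * (2 ^ i) ^ m) (m∸n+n≡m k≤w) ⟩
    w * (2 ^ i) ^ w                          ≡⟨ len≡ 5≤j ⟨
    len j                                    ∎
    where open ≡-Reasoning
  run : ∀ s → s < n → qprod (suc (a + s)) k ≡ (2 ^ i) ^ k
  run s s<n = qprod≡ 5≤j k (s≤s (≤-trans (m≤m+n (L j) (t * len j)) (m≤m+n a s))) (s≤s (begin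
    a + s + k                        ≡⟨ +-assoc a s k ⟩
    a + (s + k)                      ≤⟨ +-monoʳ-≤ a (+-monoˡ-≤ k (<⇒≤ s<n)) ⟩
    a + (n + k)                      ≡⟨ cong (a +_) n+k≡len ⟩
    L j + t * len j + len j          ≡⟨ +-assoc (L j) (t * len j) (len j) ⟩
    L j + (t * len j + len j)        ≤⟨ +-monoʳ-≤ (L j) (copy-fits j t<l) ⟩
    L (suc j)                        ∎))
    where open ≤-Reasoning
  2k≤dev : k + k ≤ deviation k j
  2k≤dev = begin
    k + k               ≡⟨ cong (k +_) (+-identityʳ k) ⟨
    2 * k               ≤⟨ *-monoˡ-≤ k (s≤s (s≤s (z≤n {j}))) ⟩
    suc i * k           ≡⟨ cong (_* k) (^-identityʳ (suc i)) ⟨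
    suc i ^ 1 * k       ≤⟨ *-monoˡ-≤ k (^-monoʳ-≤ (suc i) (s≤s (z≤n {j + j * i}))) ⟩
    suc i ^ w * k       ∎
    where open ≤-Reasoning

module _ (k J : ℕ) where

  expectedSum : ℕ → ℕ
  expectedSum zero    = 0
  expectedSum (suc d) = expectedSum d + ls (suc (J + d)) * expected k (J + d)

  deviationSum : ℕ → ℕ
  deviationSum zero    = 0
  deviationSum (suc d) = deviationSum d + ls (suc (J + d)) * deviation k (J + d)

  module _ {X} (us : UnitSteps X) (cs : ∀ j → J ≤ j → CopySteps X k j) where

    copies : ∀ j → J ≤ j → ∀ t → t ≤ ls (suc j) →
             Step (X (L j)) (X (L j + t * len j)) (t * expected k j) (t * deviation k j)
    copies j J≤j zero    t≤l = subst (λ n → Step (X (L j)) (X n) 0 0) (sym (+-identityʳ (L j))) (Step-refl _)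
    copies j J≤j (suc t) t<l = subst (λ s → s) eq
      (Step-trans (copies j J≤j t (<⇒≤ t<l)) (cs j J≤j t t<l))
      where
      idx : L j + t * len j + len j ≡ L j + suc t * len j
      idx = trans (+-assoc (L j) _ _) (cong (L j +_) (+-comm (t * len j) (len j)))
      eq : Step (X (L j)) (X (L j + t * len j + len j)) (t * expected k j + expected k j) (t * deviation k j + deviation k j)
         ≡ Step (X (L j)) (X (L j + suc t * len j)) (suc t * expected k j) (suc t * deviation k j)
      eq rewrite idx | +-comm (t * expected k j) (expected k j) | +-comm (t * deviation k j) (deviation k j) = refl

    -- All of the first L J positions are counted as error.
    segments : ∀ d → Step (X 0) (X (L (J + d))) (expectedSum d) (L J + deviationSum d)
    segments zero    = subst₂ (λ j R → Step (X 0) (X (L j)) 0 R) (sym (+-identityʳ J)) (sym (+-identityʳ (L J)))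
                         (drift us 0 (L J))
    segments (suc d) = subst₂ (λ j R → Step (X 0) (X (L j)) (expectedSum (suc d)) R) (sym (+-suc J d))
      (+-assoc (L J) (deviationSum d) _)
      (Step-trans (segments d) (copies (J + d) (m≤m+n J d) (ls (suc (J + d))) ≤-refl))

    -- Complete segments come first, then `t` complete copies, then `r` positions of an unfinished
    -- copy, which are counted entirely as error.
    prefix : ∀ d t r → t ≤ ls (suc (J + d)) →
      Step (X 0) (X (L (J + d) + t * len (J + d) + r))
           (expectedSum d + t * expected k (J + d))
           (L J + deviationSum d + t * deviation k (J + d) + r)
    prefix d t r t≤l = subst
      (λ g → Step (X 0) (X (L (J + d) + t * len (J + d) + r)) g (L J + deviationSum d + t * deviation k (J + d) + r))
      (+-identityʳ (expectedSum d + t * expected k (J + d)))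
      (Step-trans (Step-trans (segments d) (copies (J + d) (m≤m+n J d) t t≤l)) (drift us (L (J + d) + t * len (J + d)) r))

-- Negligibility of the errors.

deviation-small : ∀ {j k M} → 3 ≤ j → k ≤ suc j → M ≤ suc j → M * deviation k j ≤ expected k j
deviation-small {j} {k} {M} 3≤j k≤i M≤i = begin
  M * (suc i ^ w * k)        ≡⟨ lemma M (suc i ^ w) k ⟩
  M * k * suc i ^ w          ≤⟨ *-mono-≤ (*-mono-≤ M≤i k≤i) power-≤ ⟩
  w * (2 ^ i) ^ (w ∸ k)      ∎
  where
  open ≤-Reasoning
  i = suc j
  w = i * i
  lemma : ∀ a b c → a * (b * c) ≡ a * c * b
  lemma = solve-∀
  -- Bounding i + 1 by 2^j instead of 2^i leaves a spare factor 2^w, since iw = jw + w. It pays for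
  -- the loss of ik ≤ i² = w in the exponent. The factor Mk ≤ i² is matched by the `w` in
  -- `expected`.
  power-≤ : suc i ^ w ≤ (2 ^ i) ^ (w ∸ k)
  power-≤ = begin
    suc i ^ w             ≤⟨ ^-monoˡ-≤ w (2+n≤2^n 3≤j) ⟩
    (2 ^ j) ^ w           ≡⟨ ^-*-assoc 2 j w ⟩
    2 ^ (j * w)           ≤⟨ ^-monoʳ-≤ 2 (m+n≤o⇒m≤o∸n (j * w) (≤-trans (≤-reflexive (+-comm (j * w) (i * k)))
                                            (+-monoˡ-≤ (j * w) (*-monoʳ-≤ i k≤i)))) ⟩
    2 ^ (i * w ∸ i * k)   ≡⟨ cong (2 ^_) (*-distribˡ-∸ i w k) ⟨
    2 ^ (i * (w ∸ k))     ≡⟨ ^-*-assoc 2 i (w ∸ k) ⟨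
    (2 ^ i) ^ (w ∸ k)     ∎

-- As M, i + 1 ≤ 2^i, comparing exponents of 2 it suffices that 3 i + (i + 1)³ ≤ 4 i² + i (i² - k).
copy-short : ∀ {j k M} → 5 ≤ j → 7 + k ≤ suc j → M ≤ suc j →
             M * len (suc j) ≤ ls (suc j) * expected k j
copy-short {j} {k} {M} 5≤j 7+k≤i M≤i = begin
  M * len (suc j)                                     ≡⟨ cong (M *_) (len≡ {suc j} (m≤n⇒m≤1+n 5≤j)) ⟩
  M * (i′ * i′ * (2 ^ i′) ^ (i′ * i′))
    ≤⟨ *-mono-≤ (≤-trans M≤i (n≤2^n i)) (*-monoˡ-≤ _ (*-mono-≤ i′≤2^i i′≤2^i)) ⟩
  2 ^ i * (2 ^ i * 2 ^ i * (2 ^ i′) ^ (i′ * i′))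
    ≡⟨ cong (λ x → 2 ^ i * (2 ^ i * 2 ^ i * x)) (^-*-assoc 2 i′ (i′ * i′)) ⟩
  2 ^ i * (2 ^ i * 2 ^ i * 2 ^ (i′ * (i′ * i′)))
    ≡⟨ cong (λ x → 2 ^ i * (x * 2 ^ (i′ * (i′ * i′)))) (^-distribˡ-+-* 2 i i) ⟨
  2 ^ i * (2 ^ (i + i) * 2 ^ (i′ * (i′ * i′)))
    ≡⟨ cong (2 ^ i *_) (^-distribˡ-+-* 2 (i + i) (i′ * (i′ * i′))) ⟨
  2 ^ i * 2 ^ (i + i + i′ * (i′ * i′))                ≡⟨ ^-distribˡ-+-* 2 i (i + i + i′ * (i′ * i′)) ⟨
  2 ^ (i + (i + i + i′ * (i′ * i′)))                  ≤⟨ ^-monoʳ-≤ 2 exponent-≤ ⟩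
  2 ^ (4 * w + i * (w ∸ k))                           ≡⟨ ^-distribˡ-+-* 2 (4 * w) (i * (w ∸ k)) ⟩
  2 ^ (4 * w) * 2 ^ (i * (w ∸ k))                     ≡⟨ cong (2 ^ (4 * w) *_) (^-*-assoc 2 i (w ∸ k)) ⟨
  2 ^ (4 * w) * (2 ^ i) ^ (w ∸ k)                     ≤⟨ *-monoʳ-≤ (2 ^ (4 * w)) (m≤n*m ((2 ^ i) ^ (w ∸ k)) w) ⟩
  2 ^ (4 * w) * (w * (2 ^ i) ^ (w ∸ k))               ≡⟨ cong (_* expected k j) (ls-2^ 5≤j) ⟨
  ls (suc j) * expected k j                           ∎
  where
  open ≤-Reasoning
  i  = suc j
  i′ = suc i
  w  = i * i
  i′≤2^i : i′ ≤ 2 ^ i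
  i′≤2^i = ≤-trans (n≤1+n i′) (2+n≤2^n (≤-trans (m≤m+n 3 2) (m≤n⇒m≤1+n 5≤j)))
  k≤w : k ≤ w
  k≤w = ≤-trans (≤-trans (m≤n+m k 7) 7+k≤i) (m≤m*n i i)
  expand : ∀ i k → i + (i + i + (1 + i) * ((1 + i) * (1 + i))) + i * k ≡ 1 + (6 * i + i * k) + (3 * (i * i) + i * (i * i))
  expand = solve-∀
  collect : ∀ i k → i + (6 * i + i * k) + (3 * (i * i) + i * (i * i)) ≡ i * (7 + k) + (3 * (i * i) + i * (i * i))
  collect = solve-∀
  collect′ : ∀ w x → w + (3 * w + x) ≡ 4 * w + x
  collect′ = solve-∀
  exponent-≤ : i + (i + i + i′ * (i′ * i′)) ≤ 4 * w + i * (w ∸ k)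
  -- Adding `i * k` removes the truncated subtraction. After cancelling i³ + 3i² there remains 1 +
  -- 6i + ik ≤ i², which is where 7 + k ≤ i comes from.
  exponent-≤ = +-cancelʳ-≤ (i * k) _ _ (begin
    i + (i + i + i′ * (i′ * i′)) + i * k               ≡⟨ expand i k ⟩
    1 + (6 * i + i * k) + (3 * w + i * w)
      ≤⟨ +-monoˡ-≤ (3 * w + i * w) (+-monoˡ-≤ (6 * i + i * k) (s≤s (z≤n {j}))) ⟩
    i + (6 * i + i * k) + (3 * w + i * w)              ≡⟨ collect i k ⟩
    i * (7 + k) + (3 * w + i * w)                      ≤⟨ +-monoˡ-≤ (3 * w + i * w) (*-monoʳ-≤ i 7+k≤i) ⟩
    w + (3 * w + i * w)                                ≡⟨ collect′ w (i * w) ⟩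
    4 * w + i * w                                      ≡⟨ cong (λ x → 4 * w + i * x) (m∸n+n≡m k≤w) ⟨
    4 * w + i * (w ∸ k + k)                            ≡⟨ cong (4 * w +_) (*-distribˡ-+ i (w ∸ k) k) ⟩
    4 * w + (i * (w ∸ k) + i * k)                      ≡⟨ +-assoc (4 * w) (i * (w ∸ k)) (i * k) ⟨
    4 * w + i * (w ∸ k) + i * k                        ∎)

All-≤-sum : ∀ B → All (_≤ sum B) B
All-≤-sum []      = []
All-≤-sum (c ∷ B) = m≤m+n c (sum B) ∷ All.map (λ d≤ → ≤-trans d≤ (m≤n+m (sum B) c)) (All-≤-sum B)

module _ {k J M} (small : ∀ j → J ≤ j → M * deviation k j ≤ expected k j) where

  deviations-small : ∀ d t → M * (deviationSum k J d + t * deviation k (J + d)) ≤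
                             expectedSum k J d + t * expected k (J + d)
  deviations-small d t = begin
    M * (deviationSum k J d + t * δ)        ≡⟨ *-distribˡ-+ M (deviationSum k J d) (t * δ) ⟩
    M * deviationSum k J d + M * (t * δ)    ≤⟨ +-mono-≤ (sums d) (scale (J + d) (m≤m+n J d) t) ⟩
    expectedSum k J d + t * expected k (J + d) ∎
    where
    open ≤-Reasoning
    δ = deviation k (J + d)
    scale : ∀ j → J ≤ j → ∀ t → M * (t * deviation k j) ≤ t * expected k j
    scale j J≤j t = begin
      M * (t * deviation k j)   ≡⟨ lemma M t (deviation k j) ⟩
      t * (M * deviation k j)   ≤⟨ *-monoʳ-≤ t (small j J≤j) ⟩
      t * expected k j          ∎
      where
      lemma : ∀ a b c → a * (b * c) ≡ b * (a * c)
      lemma = solve-∀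
    sums : ∀ d → M * deviationSum k J d ≤ expectedSum k J d
    sums zero    = ≤-reflexive (*-zeroʳ M)
    sums (suc d) = begin
      M * (deviationSum k J d + ls (suc (J + d)) * deviation k (J + d))
        ≡⟨ *-distribˡ-+ M (deviationSum k J d) _ ⟩
      M * deviationSum k J d + M * (ls (suc (J + d)) * deviation k (J + d))
        ≤⟨ +-mono-≤ (sums d) (scale (J + d) (m≤m+n J d) (ls (suc (J + d)))) ⟩
      expectedSum k J (suc d)
        ∎

-- Convergence of the ratio.

locate-large : ∀ {K n} → L K ≤ n → ∃ λ j → K ≤ j × ∃ λ t → ∃ λ r →
               t ≤ ls (suc j) × r < len j × n ≡ L j + t * len j + r
locate-large {K} {n} LK≤n with j , 5≤j , Lj≤n , n<L ← locate n =
  j , K≤j , s / len j , s % len j , <⇒≤ t<l , m%n<n s (len j) , n≡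
  where
  s = n ∸ L j
  instance
    len-nonZero : NonZero (len j)
    len-nonZero = >-nonZero (len>0 5≤j)
  K≤j : K ≤ j
  K≤j = ≮⇒≥ λ j<K → <⇒≱ n<L (≤-trans (L-mono j<K) LK≤n)
  t<l : s / len j < ls (suc j)
  t<l = m<n*o⇒m/o<n (+-cancelˡ-< (L j) s _ (subst (_< L (suc j)) (sym (m+[n∸m]≡n Lj≤n)) n<L))
  n≡ : n ≡ L j + s / len j * len j + s % len j
  n≡ = begin
    n                                              ≡⟨ m+[n∸m]≡n Lj≤n ⟨
    L j + s                                        ≡⟨ cong (L j +_) (m≡m%n+[m/n]*n s (len j)) ⟩
    L j + (s % len j + s / len j * len j)          ≡⟨ cong (L j +_) (+-comm (s % len j) _) ⟩
    L j + (s / len j * len j + s % len j)          ≡⟨ +-assoc (L j) _ _ ⟨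
    L j + s / len j * len j + s % len j            ∎
    where open ≡-Reasoning

L-positive : ∀ {j} → 6 ≤ j → 0 < L j
L-positive (s≤s 5≤j) = ≤-<-trans z≤n (L-< 5≤j)

-- `J` is a threshold from which all estimates apply: `7 + length B ≤ J` serves `copy-short` and the
-- length conditions, `4M≤J` serves `copy-short` and `deviation-small`, and `B≤J` puts the digits of
-- `B` below every later i.
module _ {B : Block} {ε : ℚ} (0<ε : 0ℚ ℚ.< ε) {D : ℕ} (1≤D : 1 ≤ D) (1≤εD : 1ℚ ℚ.≤ ε ℚ.* ⟦ D ⟧)
         {J : ℕ} (7+k≤J : 7 + length B ≤ J) (4M≤J : 2 * (2 * (1 + D * 3)) ≤ J) (B≤J : All (_≤ J) B) where

  private
    k = length B
    M = 1 + D * 3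
    -- More than `L J` segments are completed after the first `L J` positions, which makes those
    -- positions no more numerous than one copy of the current block. The `suc` also guarantees a
    -- completed segment for `copy-short` to compare with.
    K = J + suc (L J)

    5≤J : 5 ≤ J
    5≤J = ≤-trans (m≤m+n 5 (2 + k)) 7+k≤J

    k≤w : ∀ j → J ≤ j → k ≤ suc j * suc j
    k≤w j J≤j = ≤-trans (≤-trans (m≤n+m k 7) (≤-trans 7+k≤J (m≤n⇒m≤1+n J≤j))) (m≤m*n (suc j) (suc j))

    N-copies : ∀ j → J ≤ j → CopySteps (λ n → ⟦ N B n ⟧) k j
    N-copies j J≤j = N-copySteps (≤-trans 5≤J J≤j) (All.map (λ c≤J → s≤s (≤-trans c≤J J≤j)) B≤J) (k≤w j J≤j)

    Q-copies : ∀ j → J ≤ j → CopySteps (λ n → Qk n k) k j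
    Q-copies j J≤j = Q-copySteps (≤-trans 5≤J J≤j) k (k≤w j J≤j)

    small : ∀ j → J ≤ j → 2 * M * deviation k j ≤ expected k j
    small j J≤j = deviation-small (≤-trans (m≤m+n 3 2) (≤-trans 5≤J J≤j))
      (≤-trans (m≤n+m k 7) (≤-trans 7+k≤J (m≤n⇒m≤1+n J≤j)))
      (≤-trans (m≤n*m (2 * M) 2) (≤-trans 4M≤J (m≤n⇒m≤1+n J≤j)))

    -- After doubling, the main term `G` is available twice. One `G` absorbs the deviations. For the
    -- other, `L J + r` is at most two copy lengths of segment `J + suc d`, and `copy-short` bounds
    -- 4M such lengths by the expected total of the preceding segment, a summand of `G`.
    error-small : ∀ d t r → L J ≤ d → r < len (J + suc d) →
      M * (L J + deviationSum k J (suc d) + t * deviation k (J + suc d) + r) ≤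
      expectedSum k J (suc d) + t * expected k (J + suc d)
    error-small d t r LJ≤d r<len = *-cancelˡ-≤ 2 (begin
      2 * (M * (L J + Δ + t * δ + r))              ≡⟨ lemma M (L J) Δ (t * δ) r ⟩
      2 * M * (Δ + t * δ) + 2 * M * (L J + r)
        ≤⟨ +-mono-≤ (deviations-small {k} {J} {2 * M} small (suc d) t) tail ⟩
      G + G                                        ≡⟨ cong (G +_) (+-identityʳ G) ⟨
      2 * G                                        ∎)
      where
      open ≤-Reasoning
      Δ = deviationSum k J (suc d)
      δ = deviation k (J + suc d)
      G = expectedSum k J (suc d) + t * expected k (J + suc d)
      lemma : ∀ m a b c r → 2 * (m * (a + b + c + r)) ≡ 2 * m * (b + c) + 2 * m * (a + r)
      lemma = solve-∀
      double : ∀ m x → 2 * m * (x + x) ≡ 2 * (2 * m) * x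
      double = solve-∀
      5≤J+d : 5 ≤ J + d
      5≤J+d = ≤-trans 5≤J (m≤m+n J d)
      LJ≤len : L J ≤ len (suc (J + d))
      LJ≤len = ≤-trans (≤-trans LJ≤d (≤-trans (m≤n+m d J) (≤-trans (n≤1+n _) (n≤1+n _))))
        (≤-trans (m≤m*n (suc (suc (J + d))) (suc (suc (J + d)))) (w≤len (m≤n⇒m≤1+n 5≤J+d)))
      tail : 2 * M * (L J + r) ≤ G
      tail = begin
        2 * M * (L J + r)
          ≤⟨ *-monoʳ-≤ (2 * M) (+-mono-≤ LJ≤len (<⇒≤ (subst (λ j → r < len j) (+-suc J d) r<len))) ⟩
        2 * M * (len (suc (J + d)) + len (suc (J + d)))           ≡⟨ double M (len (suc (J + d))) ⟩
        2 * (2 * M) * len (suc (J + d))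
          ≤⟨ copy-short 5≤J+d (≤-trans 7+k≤J (≤-trans (m≤m+n J d) (n≤1+n _))) (≤-trans 4M≤J (≤-trans (m≤m+n J d) (n≤1+n _))) ⟩
        ls (suc (J + d)) * expected k (J + d)                     ≤⟨ m≤n+m _ (expectedSum k J d) ⟩
        expectedSum k J (suc d)                                   ≤⟨ m≤m+n _ _ ⟩
        G                                                         ∎

  ratio-converges : ∃ λ n₀ → ∀ n → n₀ ≤ n → ℚ.∣ ratio ⟦ N B n ⟧ (Qk n k) ℚ.- 1ℚ ∣ ℚ.< ε
  ratio-converges = L K , λ n LK≤n → from-location (locate-large {K} LK≤n)
    where
    from-location : ∀ {n} → (∃ λ j → K ≤ j × ∃ λ t → ∃ λ r → t ≤ ls (suc j) × r < len j × n ≡ L j + t * len j + r) →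
                    ℚ.∣ ratio ⟦ N B n ⟧ (Qk n k) ℚ.- 1ℚ ∣ ℚ.< ε
    from-location (j , K≤j , t , r , t≤l , r<len , refl) with j ∸ K | m+[n∸m]≡n K≤j
    ... | d | refl rewrite +-assoc J (suc (L J)) d = ratio-near-1 0<ε
      1≤D 1≤εD
      -- `ratio-near-1` asks for an error of at least 1; the summand `L J` supplies it, being
      -- positive because `J` is at least 6.
      (≤-trans (L-positive (≤-trans (m≤m+n 6 (1 + k)) 7+k≤J)) (≤-trans (m≤m+n (L J) _) (≤-trans (m≤m+n _ _) (m≤m+n _ r))))
      (error-small (L J + d) t r (m≤m+n (L J) d) r<len)
      (prefix k J (N-unitSteps B) N-copies (suc (L J + d)) t r t≤l)
      (prefix k J (Q-unitSteps k) Q-copies (suc (L J + d)) t r t≤l)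

qNormal : QNormal
qNormal k 1≤k B refl ε 0<ε with D , 1≤D , 1≤εD ← archimedean ε 0<ε =
  -- The sum of three thresholds serves as a common upper bound for them; `sum B` bounds every digit
  -- of `B`.
  ratio-converges 0<ε 1≤D 1≤εD {a + b + c}
    (≤-trans (m≤m+n a b) (m≤m+n (a + b) c))
    (≤-trans (m≤n+m b a) (m≤m+n (a + b) c))
    (All.map (λ d≤ → ≤-trans d≤ (m≤n+m c (a + b))) (All-≤-sum B))
  where
  a = 7 + length B
  b = 2 * (2 * (1 + D * 3))
  c = sum B

theorem3 : ValidDigits × QNormal
theorem3 = validDigits , qNormal
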